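{- Consider the following rows of Gauss words: Row 1: $\{w_1,w_2\}\cup\{w_3,w_4\}$ with $w_1=$ABCDBEACED, $w_2=$ABCDECAEBD, $w_3=$ABCADBECDE, $w_4=$ABCACDEDBE. Row 2: ABCBDAEDCE, ABCDCAEBDE. Row 3: ABCACDBEDE. Row 4: ABACDCEDBE. Row 5: ABACDCEBED, ABCDCAEDEB, ABCBDEDCAE, ABACDEDBCE, ABCDCEBDAE. Row 6: ABCBDCEAED. Row 7: ABCDECEADB. Row 8: ABCDCEDAEB, ABCDEBDACE. Row 9: ABCDEBECAD, ABCDCEBEAD, ABCDCAEBED. Row 10: ABCADBDECE, ABCDBDAECE. Row 11: ABACDCEBDE, ABACDEDBEC. Row 12: ABCADCDEBE. Row 13: ABACBDCEDE. Row 14: ABACDBECED, ABACDBDECE. Row 15: ABCDBEDEAC, ABCDEADBEC. Row 16: ABCBDCEDEA. Row 17: ABACDBCEDE, ABCBDCAEDE, ABACDBEDEC. Row 18: ABCADCEBED, ABCADEBECD. Row 19: ABCADEDCEB. Row 20: ABCBDCEADE, ABCBDEDAEC, ABCDACEDBE, ABCDAEBDEC. Row 21: ABCDEDBECA, ABCBDAECDE, ABCBDEDCEA, ABCDCAEDBE, ABCDCEBDEA. Row 22: ABCDBECAED, ABCDBDEACE, ABCDEACEBD. Row 23: ABCDBEADEC, ABCDECADBE, ABCADEDBEC. Row 24: ABCDCADEBE. Row 25: ABCADECDBE, ABCADBEDEC, ABCDBECADE, ABCDBDEAEC. Row 26: ABCADECEBD, ABCDBECEDA, ABCDECEBDA,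 ABCDBDECEA, ABCADBECED. Row 27: ABACDECEBD. Row 28: ABCDBDECAE. Row 29: ABCBDEAECD, ABCDEDACEB, ABCDCEAEDB. Row 30: ABACBDEDCE. Row 31: ABCDADECEB, ABCDAECEDB, ABCBDADECE, ABCDADBECE, ABCBDECEAD. Row 32: ABCBDAECED. Row 33: ABCBDAEDEC. Row 34: ABCDEDBEAC. Row 35: ABACDCBEDE, ABCBDACEDE. Row 36: ABACDCBD, ABCBDACD, ABCDCADB. Row 37: ABCACDBD, ABCADBDC, ABCDBDAC. Row 38: ABACBDCD. Then: (a) for each $i\in\{2,\dots,38\}$, all words in Row $i$ are homotopic to each other; moreover $w_1$ is homotopic to $w_2$ and $w_3$ is homotopic to $w_4$; (b) a word in Row $i$ is not homotopic to any word in Row $j$ whenever $i\neq j$; (c) every Gauss word of rank at most $5$ that is not isomorphic to a word in the rows above is homotopic to the empty word or to a Gauss word of rank at most $4$. (No assertion is made as to whether $w_1$ is homotopic to $w_3$.)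
   Context: A Gauss word is a finite sequence of letters in which every letter that occurs appears exactly twice (the empty word is allowed). Its rank is the number of distinct letters in it. Two Gauss words are isomorphic if there is a bijection between their sets of letters which transforms the first word into the second. Homotopy moves, for arbitrary (possibly empty) words $x,y,z,t$ such that both sides are Gauss words: (H1) $xAAy\leftrightarrow xy$; (H2) $xAByBAz\leftrightarrow xyz$; (H3) $xAByACzBCt\leftrightarrow xBAyCAzCBt$. Homotopy is the equivalence relation on Gauss words generated by isomorphism and the moves H1–H3. -}

module Defs where

open import Data.Nat using (ℕ; zero; suc; _≟_)
open import Data.List using (List; []; _∷_; _++_; map; length; deduplicate)
open import Data.List.Membership.Propositional using (_∈_)
open import Data.Product using (Σ; _×_)
open import Relation.Binary.PropositionalEquality using (_≡_)
open import Relation.Nullary using (yes; no)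

Word : Set
Word = List ℕ

occ : ℕ → Word → ℕ
occ a [] = zero
occ a (b ∷ w) with a ≟ b
... | yes _ = suc (occ a w)
... | no _  = occ a w

IsGauss : Word → Set
IsGauss w = ∀ a → a ∈ w → occ a w ≡ 2

rank : Word → ℕ
rank w = length (deduplicate _≟_ w)

-- isomorphism: a bijection from the letters of u onto the letters of v
-- transforming u into v (f injective on the letters of u, map f u ≡ v;
-- then the letters of v are exactly the image of those of u)
Iso : Word → Word → Set
Iso u v = Σ (ℕ → ℕ) λ f →
  (∀ a b → a ∈ u → b ∈ u → f a ≡ f b → a ≡ b) × (map f u ≡ v)

data Move : Word → Word → Set where
  H1 : ∀ (x y : Word) (A : ℕ) →
       IsGauss (x ++ A ∷ A ∷ y) → IsGauss (x ++ y) →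
       Move (x ++ A ∷ A ∷ y) (x ++ y)
  H2 : ∀ (x y z : Word) (A B : ℕ) →
       IsGauss (x ++ A ∷ B ∷ y ++ B ∷ A ∷ z) → IsGauss (x ++ y ++ z) →
       Move (x ++ A ∷ B ∷ y ++ B ∷ A ∷ z) (x ++ y ++ z)
  H3 : ∀ (x y z t : Word) (A B C : ℕ) →
       IsGauss (x ++ A ∷ B ∷ y ++ A ∷ C ∷ z ++ B ∷ C ∷ t) →
       IsGauss (x ++ B ∷ A ∷ y ++ C ∷ A ∷ z ++ C ∷ B ∷ t) →
       Move (x ++ A ∷ B ∷ y ++ A ∷ C ∷ z ++ B ∷ C ∷ t)
            (x ++ B ∷ A ∷ y ++ C ∷ A ∷ z ++ C ∷ B ∷ t)

data Homotopic : Word → Word → Set where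
  h-refl  : ∀ {u} → Homotopic u u
  h-sym   : ∀ {u v} → Homotopic u v → Homotopic v u
  h-trans : ∀ {u v w} → Homotopic u v → Homotopic v w → Homotopic u w
  h-iso   : ∀ {u v} → IsGauss u → Iso u v → Homotopic u v
  h-move  : ∀ {u v} → Move u v → Homotopic u v

A B C D E : ℕ
A = 0
B = 1
C = 2
D = 3
E = 4

w₁ w₂ w₃ w₄ : Word
w₁ = A ∷ B ∷ C ∷ D ∷ B ∷ E ∷ A ∷ C ∷ E ∷ D ∷ []
w₂ = A ∷ B ∷ C ∷ D ∷ E ∷ C ∷ A ∷ E ∷ B ∷ D ∷ []
w₃ = A ∷ B ∷ C ∷ A ∷ D ∷ B ∷ E ∷ C ∷ D ∷ E ∷ []
w₄ = A ∷ B ∷ C ∷ A ∷ C ∷ D ∷ E ∷ D ∷ B ∷ E ∷ []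

-- Rows 1..38 of the table (row 1 = {w₁,w₂} ∪ {w₃,w₄}); row i = [] otherwise
rowTable : List (List Word)
rowTable =
 -- row 0 (unused)
    [] ∷
    ((A ∷ B ∷ C ∷ D ∷ B ∷ E ∷ A ∷ C ∷ E ∷ D ∷ []) ∷ (A ∷ B ∷ C ∷ D ∷ E ∷ C ∷ A ∷ E ∷ B ∷ D ∷ []) ∷ (A ∷ B ∷ C ∷ A ∷ D ∷ B ∷ E ∷ C ∷ D ∷ E ∷ []) ∷ (A ∷ B ∷ C ∷ A ∷ C ∷ D ∷ E ∷ D ∷ B ∷ E ∷ []) ∷ []) ∷
    ((A ∷ B ∷ C ∷ B ∷ D ∷ A ∷ E ∷ D ∷ C ∷ E ∷ []) ∷ (A ∷ B ∷ C ∷ D ∷ C ∷ A ∷ E ∷ B ∷ D ∷ E ∷ []) ∷ []) ∷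
    ((A ∷ B ∷ C ∷ A ∷ C ∷ D ∷ B ∷ E ∷ D ∷ E ∷ []) ∷ []) ∷
    ((A ∷ B ∷ A ∷ C ∷ D ∷ C ∷ E ∷ D ∷ B ∷ E ∷ []) ∷ []) ∷
    ((A ∷ B ∷ A ∷ C ∷ D ∷ C ∷ E ∷ B ∷ E ∷ D ∷ []) ∷ (A ∷ B ∷ C ∷ D ∷ C ∷ A ∷ E ∷ D ∷ E ∷ B ∷ []) ∷ (A ∷ B ∷ C ∷ B ∷ D ∷ E ∷ D ∷ C ∷ A ∷ E ∷ []) ∷ (A ∷ B ∷ A ∷ C ∷ D ∷ E ∷ D ∷ B ∷ C ∷ E ∷ []) ∷ (A ∷ B ∷ C ∷ D ∷ C ∷ E ∷ B ∷ D ∷ A ∷ E ∷ []) ∷ []) ∷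
    ((A ∷ B ∷ C ∷ B ∷ D ∷ C ∷ E ∷ A ∷ E ∷ D ∷ []) ∷ []) ∷
    ((A ∷ B ∷ C ∷ D ∷ E ∷ C ∷ E ∷ A ∷ D ∷ B ∷ []) ∷ []) ∷
    ((A ∷ B ∷ C ∷ D ∷ C ∷ E ∷ D ∷ A ∷ E ∷ B ∷ []) ∷ (A ∷ B ∷ C ∷ D ∷ E ∷ B ∷ D ∷ A ∷ C ∷ E ∷ []) ∷ []) ∷
    ((A ∷ B ∷ C ∷ D ∷ E ∷ B ∷ E ∷ C ∷ A ∷ D ∷ []) ∷ (A ∷ B ∷ C ∷ D ∷ C ∷ E ∷ B ∷ E ∷ A ∷ D ∷ []) ∷ (A ∷ B ∷ C ∷ D ∷ C ∷ A ∷ E ∷ B ∷ E ∷ D ∷ []) ∷ []) ∷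
    ((A ∷ B ∷ C ∷ A ∷ D ∷ B ∷ D ∷ E ∷ C ∷ E ∷ []) ∷ (A ∷ B ∷ C ∷ D ∷ B ∷ D ∷ A ∷ E ∷ C ∷ E ∷ []) ∷ []) ∷
    ((A ∷ B ∷ A ∷ C ∷ D ∷ C ∷ E ∷ B ∷ D ∷ E ∷ []) ∷ (A ∷ B ∷ A ∷ C ∷ D ∷ E ∷ D ∷ B ∷ E ∷ C ∷ []) ∷ []) ∷
    ((A ∷ B ∷ C ∷ A ∷ D ∷ C ∷ D ∷ E ∷ B ∷ E ∷ []) ∷ []) ∷
    ((A ∷ B ∷ A ∷ C ∷ B ∷ D ∷ C ∷ E ∷ D ∷ E ∷ []) ∷ []) ∷
    ((A ∷ B ∷ A ∷ C ∷ D ∷ B ∷ E ∷ C ∷ E ∷ D ∷ []) ∷ (A ∷ B ∷ A ∷ C ∷ D ∷ B ∷ D ∷ E ∷ C ∷ E ∷ []) ∷ []) ∷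
    ((A ∷ B ∷ C ∷ D ∷ B ∷ E ∷ D ∷ E ∷ A ∷ C ∷ []) ∷ (A ∷ B ∷ C ∷ D ∷ E ∷ A ∷ D ∷ B ∷ E ∷ C ∷ []) ∷ []) ∷
    ((A ∷ B ∷ C ∷ B ∷ D ∷ C ∷ E ∷ D ∷ E ∷ A ∷ []) ∷ []) ∷
    ((A ∷ B ∷ A ∷ C ∷ D ∷ B ∷ C ∷ E ∷ D ∷ E ∷ []) ∷ (A ∷ B ∷ C ∷ B ∷ D ∷ C ∷ A ∷ E ∷ D ∷ E ∷ []) ∷ (A ∷ B ∷ A ∷ C ∷ D ∷ B ∷ E ∷ D ∷ E ∷ C ∷ []) ∷ []) ∷
    ((A ∷ B ∷ C ∷ A ∷ D ∷ C ∷ E ∷ B ∷ E ∷ D ∷ []) ∷ (A ∷ B ∷ C ∷ A ∷ D ∷ E ∷ B ∷ E ∷ C ∷ D ∷ []) ∷ []) ∷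
    ((A ∷ B ∷ C ∷ A ∷ D ∷ E ∷ D ∷ C ∷ E ∷ B ∷ []) ∷ []) ∷
    ((A ∷ B ∷ C ∷ B ∷ D ∷ C ∷ E ∷ A ∷ D ∷ E ∷ []) ∷ (A ∷ B ∷ C ∷ B ∷ D ∷ E ∷ D ∷ A ∷ E ∷ C ∷ []) ∷ (A ∷ B ∷ C ∷ D ∷ A ∷ C ∷ E ∷ D ∷ B ∷ E ∷ []) ∷ (A ∷ B ∷ C ∷ D ∷ A ∷ E ∷ B ∷ D ∷ E ∷ C ∷ []) ∷ []) ∷
    ((A ∷ B ∷ C ∷ D ∷ E ∷ D ∷ B ∷ E ∷ C ∷ A ∷ []) ∷ (A ∷ B ∷ C ∷ B ∷ D ∷ A ∷ E ∷ C ∷ D ∷ E ∷ []) ∷ (A ∷ B ∷ C ∷ B ∷ D ∷ E ∷ D ∷ C ∷ E ∷ A ∷ []) ∷ (A ∷ B ∷ C ∷ D ∷ C ∷ A ∷ E ∷ D ∷ B ∷ E ∷ []) ∷ (A ∷ B ∷ C ∷ D ∷ C ∷ E ∷ B ∷ D ∷ E ∷ A ∷ []) ∷ []) ∷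
    ((A ∷ B ∷ C ∷ D ∷ B ∷ E ∷ C ∷ A ∷ E ∷ D ∷ []) ∷ (A ∷ B ∷ C ∷ D ∷ B ∷ D ∷ E ∷ A ∷ C ∷ E ∷ []) ∷ (A ∷ B ∷ C ∷ D ∷ E ∷ A ∷ C ∷ E ∷ B ∷ D ∷ []) ∷ []) ∷
    ((A ∷ B ∷ C ∷ D ∷ B ∷ E ∷ A ∷ D ∷ E ∷ C ∷ []) ∷ (A ∷ B ∷ C ∷ D ∷ E ∷ C ∷ A ∷ D ∷ B ∷ E ∷ []) ∷ (A ∷ B ∷ C ∷ A ∷ D ∷ E ∷ D ∷ B ∷ E ∷ C ∷ []) ∷ []) ∷
    ((A ∷ B ∷ C ∷ D ∷ C ∷ A ∷ D ∷ E ∷ B ∷ E ∷ []) ∷ []) ∷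
    ((A ∷ B ∷ C ∷ A ∷ D ∷ E ∷ C ∷ D ∷ B ∷ E ∷ []) ∷ (A ∷ B ∷ C ∷ A ∷ D ∷ B ∷ E ∷ D ∷ E ∷ C ∷ []) ∷ (A ∷ B ∷ C ∷ D ∷ B ∷ E ∷ C ∷ A ∷ D ∷ E ∷ []) ∷ (A ∷ B ∷ C ∷ D ∷ B ∷ D ∷ E ∷ A ∷ E ∷ C ∷ []) ∷ []) ∷
    ((A ∷ B ∷ C ∷ A ∷ D ∷ E ∷ C ∷ E ∷ B ∷ D ∷ []) ∷ (A ∷ B ∷ C ∷ D ∷ B ∷ E ∷ C ∷ E ∷ D ∷ A ∷ []) ∷ (A ∷ B ∷ C ∷ D ∷ E ∷ C ∷ E ∷ B ∷ D ∷ A ∷ []) ∷ (A ∷ B ∷ C ∷ D ∷ B ∷ D ∷ E ∷ C ∷ E ∷ A ∷ []) ∷ (A ∷ B ∷ C ∷ A ∷ D ∷ B ∷ E ∷ C ∷ E ∷ D ∷ []) ∷ []) ∷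
    ((A ∷ B ∷ A ∷ C ∷ D ∷ E ∷ C ∷ E ∷ B ∷ D ∷ []) ∷ []) ∷
    ((A ∷ B ∷ C ∷ D ∷ B ∷ D ∷ E ∷ C ∷ A ∷ E ∷ []) ∷ []) ∷
    ((A ∷ B ∷ C ∷ B ∷ D ∷ E ∷ A ∷ E ∷ C ∷ D ∷ []) ∷ (A ∷ B ∷ C ∷ D ∷ E ∷ D ∷ A ∷ C ∷ E ∷ B ∷ []) ∷ (A ∷ B ∷ C ∷ D ∷ C ∷ E ∷ A ∷ E ∷ D ∷ B ∷ []) ∷ []) ∷
    ((A ∷ B ∷ A ∷ C ∷ B ∷ D ∷ E ∷ D ∷ C ∷ E ∷ []) ∷ []) ∷
    ((A ∷ B ∷ C ∷ D ∷ A ∷ D ∷ E ∷ C ∷ E ∷ B ∷ []) ∷ (A ∷ B ∷ C ∷ D ∷ A ∷ E ∷ C ∷ E ∷ D ∷ B ∷ []) ∷ (A ∷ B ∷ C ∷ B ∷ D ∷ A ∷ D ∷ E ∷ C ∷ E ∷ []) ∷ (A ∷ B ∷ C ∷ D ∷ A ∷ D ∷ B ∷ E ∷ C ∷ E ∷ []) ∷ (A ∷ B ∷ C ∷ B ∷ D ∷ E ∷ C ∷ E ∷ A ∷ D ∷ []) ∷ []) ∷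
    ((A ∷ B ∷ C ∷ B ∷ D ∷ A ∷ E ∷ C ∷ E ∷ D ∷ []) ∷ []) ∷
    ((A ∷ B ∷ C ∷ B ∷ D ∷ A ∷ E ∷ D ∷ E ∷ C ∷ []) ∷ []) ∷
    ((A ∷ B ∷ C ∷ D ∷ E ∷ D ∷ B ∷ E ∷ A ∷ C ∷ []) ∷ []) ∷
    ((A ∷ B ∷ A ∷ C ∷ D ∷ C ∷ B ∷ E ∷ D ∷ E ∷ []) ∷ (A ∷ B ∷ C ∷ B ∷ D ∷ A ∷ C ∷ E ∷ D ∷ E ∷ []) ∷ []) ∷
    ((A ∷ B ∷ A ∷ C ∷ D ∷ C ∷ B ∷ D ∷ []) ∷ (A ∷ B ∷ C ∷ B ∷ D ∷ A ∷ C ∷ D ∷ []) ∷ (A ∷ B ∷ C ∷ D ∷ C ∷ A ∷ D ∷ B ∷ []) ∷ []) ∷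
    ((A ∷ B ∷ C ∷ A ∷ C ∷ D ∷ B ∷ D ∷ []) ∷ (A ∷ B ∷ C ∷ A ∷ D ∷ B ∷ D ∷ C ∷ []) ∷ (A ∷ B ∷ C ∷ D ∷ B ∷ D ∷ A ∷ C ∷ []) ∷ []) ∷
    ((A ∷ B ∷ A ∷ C ∷ B ∷ D ∷ C ∷ D ∷ []) ∷ []) ∷
    []

nth : ℕ → List (List Word) → List Word
nth _ [] = []
nth zero (r ∷ _) = r
nth (suc n) (_ ∷ rs) = nth n rs

row : ℕ → List Word
row i = nth i rowTable

{-# OPTIONS --safe #-}
-- Besides (H1)–(H3), the cancellation of xAByABz and the three other versions of (H3), in
-- which the letters of the second or third pair are interchanged, are compositions of moves.
-- With them all homotopies claimed in (a) and (c) exist among words of rank at most 5, and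
-- they are found by a search.
--
-- For (b), colour a letter by the parity of the number of letters linked with it.  This
-- parity survives the moves; it is even for A in (H1), it agrees for A and B in (H2), and
-- the three parities add up to zero in (H3).  A function φ from coloured words to 𝔽₂ gives
-- the homotopy invariant w ↦ Σ φ(u), the sum over all subwords u of w, if φ vanishes on
-- xAAy for even A and on xAByBAz for A, B of the same colour, and if for the two sides of
-- (H3) the sums of φ over the deletions of letters among A, B, C are equal.  When φ vanishes
-- on long words these are finitely many conditions.  Eight solutions φ, found by linear
-- algebra, separate the 38 rows.
module Submission where

open import Defs
open import Algebra.Bundles using (CommutativeRing)
open import Data.Bool as Bool using (Bool; true; false; not; _xor_; _∧_; _∨_; T)
open import Data.Bool.ListAction using (all; any)
open import Data.Bool.Properties using (T-∧; T-∨; not-involutive; xor-∧-commutativeRing; xor-same; xor-identityʳ)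
open import Algebra.Properties.CommutativeSemigroup (CommutativeRing.+-commutativeSemigroup xor-∧-commutativeRing)
  using () renaming (interchange to xor-interchange)
open import Data.Bool.Solver using (module xor-∧-Solver)
open xor-∧-Solver using (solve; _:=_; _:+_; _:*_; con)
open import Data.Empty using (⊥)
open import Data.List
  using (List; []; _∷_; [_]; _++_; map; length; deduplicate; filter; concat; concatMap; upTo; drop)
open import Data.List.Membership.Propositional using (_∈_; _∉_; lose)
open import Data.List.Membership.Propositional.Properties
  using (∈-++⁺ˡ; ∈-++⁺ʳ; ∈-++⁻; ∈-map⁺; ∈-map⁻; ∈-filter⁺; ∈-filter⁻; ∈-concatMap⁺; ∈-∃++; ∈-upTo⁺;
         ∈-deduplicate⁺; ∈-deduplicate⁻)
open import Data.List.Membership.Propositional.Properties.WithK using (unique∧set⇒bag)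
open import Data.List.Properties
  using (≡-dec; ++-identityʳ; ++-assoc; map-++; map-∘; map-cong-local; map-id-local; length-map; length-++;
         filter-++; filter-all; filter-accept; filter-reject)
open import Data.List.Relation.Binary.BagAndSetEquality using (∼bag⇒↭)
open import Data.List.Relation.Binary.Permutation.Propositional
  using (_↭_; refl; prep; swap; ↭-sym; ↭-trans; ↭-reflexive) renaming (trans to ↭-compose)
open import Data.List.Relation.Binary.Permutation.Propositional.Properties
  using (∈-resp-↭; ↭-length; ++⁺ˡ; shift; shifts)
open import Data.List.Relation.Unary.All as All using (All; []; _∷_)
open import Data.List.Relation.Unary.All.Properties using (all⁺; ++⁺; ++⁻)
open import Data.List.Relation.Unary.AllPairs using (AllPairs; []; _∷_; allPairs?)
open import Data.List.Relation.Unary.Any as Any using (Any; here; there)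
open import Data.List.Relation.Unary.Any.Properties using (any⁺)
open import Data.List.Relation.Unary.Unique.Propositional.Properties using (filter⁺)
open import Data.Nat
  using (ℕ; zero; suc; _+_; _*_; _/_; _%_; _≤_; _<_; z≤n; s≤s; _≡ᵇ_; _≟_; _≤?_)
open import Data.List.Membership.DecPropositional _≟_ using (_∈?_)
open import Data.List.Membership.DecPropositional (≡-dec _≟_) using () renaming (_∈?_ to _∈ʷ?_)
open import Data.List.Relation.Unary.Unique.DecPropositional.Properties _≟_ using (deduplicate-!)
open import Data.Nat.Divisibility using (n∣m*n)
open import Data.Nat.DivMod using ([m+kn]%n≡m%n; m%n<n; m<n⇒m/n≡0; m*n/n≡m; +-distrib-/-∣ʳ)
open import Data.Nat.ListAction using (sum)
open import Data.Nat.Properties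
  using (suc-injective; 1+n≢n; +-assoc; +-comm; +-identityʳ; ≤-refl; ≤-trans; ≤-antisym; ≤-decTotalOrder;
         ≮⇒≥; ≰⇒>; <⇒≱; 1+n≰n; n≤1+n; m≤m+n; m≤n+m; +-monoʳ-≤; *-monoˡ-≤; +-monoˡ-<; <-≤-trans; <-irrefl;
         <-cmp; m<n⇒m<1+n; ≡⇒≡ᵇ)
open import Data.List.Sort.InsertionSort.Base ≤-decTotalOrder using (sort)
open import Data.List.Sort.InsertionSort.Properties ≤-decTotalOrder using (sort-↭)
open import Data.Product using (Σ; ∃; ∃₂; _×_; _,_; proj₁; proj₂)
open import Data.Sum using (_⊎_; inj₁; inj₂)
open import Data.Unit using (tt)
open import Function using (_∘_; mk⇔; Equivalence)
open import Relation.Binary.Definitions using (tri<; tri≈; tri>)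
open import Relation.Binary.PropositionalEquality
  using (_≡_; _≢_; refl; sym; trans; cong; cong₂; subst; subst₂; module ≡-Reasoning)
open import Relation.Nullary using (¬_; Dec; yes; no; contradiction; ¬?)
open import Relation.Nullary.Decidable
  using (True; False; toWitness; toWitnessFalse; does; map′; T?; _×-dec_; dec-true; dec-false)

-- Words cut into blocks

-- The moves involve words of any length, while every check is a finite computation. The link is
-- that a word is handled as a list of block indices: the letters of a move are blocks of their own,
-- and x, y, z, t are the other blocks. Deleting a letter of the move changes only the index list;
-- deleting any other letter changes only the contents of the blocks. The sum over subwords thus
-- becomes a sum, over the choices of outer letters, of one expression in a few fixed index lists,
-- and invariance can be shown for each choice separately. Gauss conditions likewise reduce to
-- sorting index lists.
--
-- A letter takes its colour from the whole word and keeps it when other letters are deleted. An odd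
-- letter can therefore occupy adjacent places in a subword, although it never does so in the word
-- itself. There φ need not vanish, a freedom used already by the first table, whose only word is 0
-- 3 3 0. Colours are stored as residues of the letters modulo 2, so that coloured words are again
-- words and the same machinery serves both.

occ-here : ∀ a w → occ a (a ∷ w) ≡ suc (occ a w)
occ-here a w with a ≟ a
... | yes _  = refl
... | no a≢a = contradiction refl a≢a

occ-there : ∀ {a b} w → a ≢ b → occ a (b ∷ w) ≡ occ a w
occ-there {a} {b} w a≢b with a ≟ b
... | yes a≡b = contradiction a≡b a≢b
... | no _    = refl

∉⇒occ≡0 : ∀ {a} w → a ∉ w → occ a w ≡ 0
∉⇒occ≡0 [] a∉w = refl
∉⇒occ≡0 (b ∷ w) a∉w =
  trans (occ-there w (a∉w ∘ here)) (∉⇒occ≡0 w (a∉w ∘ there))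

occ≡0⇒∉ : ∀ {a w} → occ a w ≡ 0 → a ∉ w
occ≡0⇒∉ {a} {b ∷ w} eq a∈ with a ≟ b
occ≡0⇒∉ {a} {b ∷ w} () a∈ | yes _
occ≡0⇒∉ {a} {b ∷ w} eq (here a≡b) | no a≢b = a≢b a≡b
occ≡0⇒∉ {a} {b ∷ w} eq (there a∈) | no _ = occ≡0⇒∉ eq a∈

occ-∷ : ∀ a b w → occ a (b ∷ w) ≡ occ a [ b ] + occ a w
occ-∷ a b w with a ≟ b
... | yes _ = refl
... | no _  = refl

occ-++ : ∀ a u v → occ a (u ++ v) ≡ occ a u + occ a v
occ-++ a [] v = refl
occ-++ a (b ∷ u) v
  rewrite occ-∷ a b (u ++ v) | occ-∷ a b u | occ-++ a u v = sym (+-assoc (occ a [ b ]) _ _)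

occ-↭ : ∀ {u v} a → u ↭ v → occ a u ≡ occ a v
occ-↭ a refl = refl
occ-↭ a (prep {u} {v} b p)
  rewrite occ-∷ a b u | occ-∷ a b v = cong (occ a [ b ] +_) (occ-↭ a p)
occ-↭ a (swap {u} {v} b c p)
  rewrite occ-++ a (b ∷ c ∷ []) u | occ-++ a (c ∷ b ∷ []) v | occ-∷ a b [ c ] | occ-∷ a c [ b ] =
  cong₂ _+_ (+-comm (occ a [ b ]) (occ a [ c ])) (occ-↭ a p)
occ-↭ a (↭-compose p q) = trans (occ-↭ a p) (occ-↭ a q)

IsGauss-↭ : ∀ {u v} → u ↭ v → IsGauss u → IsGauss v
IsGauss-↭ p g a a∈v =
  trans (sym (occ-↭ a p)) (g a (∈-resp-↭ (↭-sym p) a∈v))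

IsGauss-insert : ∀ {a w} → a ∉ w → IsGauss w → IsGauss (a ∷ a ∷ w)
IsGauss-insert {a} {w} a∉w g b b∈ with b ≟ a
IsGauss-insert {a} {w} a∉w g b b∈ | yes refl
  rewrite occ-here b w = cong (suc ∘ suc) (∉⇒occ≡0 w a∉w)
IsGauss-insert {a} {w} a∉w g b b∈ | no b≢a
  rewrite occ-there w b≢a = g b (strip b∈)
  where
  strip : b ∈ a ∷ a ∷ w → b ∈ w
  strip (here b≡a)         = contradiction b≡a b≢a
  strip (there (here b≡a)) = contradiction b≡a b≢a
  strip (there (there i))  = i

IsGauss-fresh : ∀ {a w} → IsGauss (a ∷ a ∷ w) → a ∉ w
IsGauss-fresh {a} {w} g = occ≡0⇒∉ (suc-injective (suc-injective
  (trans
    (sym (trans (occ-here a (a ∷ w)) (cong suc (occ-here a w))))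
    (g a (here refl)))))

IsGauss-delete : ∀ {a w} → IsGauss (a ∷ a ∷ w) → IsGauss w
IsGauss-delete {a} {w} g b b∈w with b ≟ a
... | yes refl = contradiction b∈w (IsGauss-fresh g)
... | no b≢a   = trans
  (sym (trans (occ-there (a ∷ w) b≢a) (occ-there w b≢a)))
  (g b (there (there b∈w)))

-- A word cut into blocks is written plug ρ p, where the pattern p lists the
-- indices of the blocks ρ 0, ρ 1, …; for a pattern given as a list literal it
-- unfolds to the expression x ++ A ∷ B ∷ y ++ … in which the moves are stated.
frame : List Word → ℕ → Word
frame [] _ = []
frame (b ∷ bs) zero = b
frame (b ∷ bs) (suc i) = frame bs i

plug : (ℕ → Word) → List ℕ → Word
plug ρ [] = []
plug ρ (i ∷ []) = ρ i
plug ρ (i ∷ p@(_ ∷ _)) = ρ i ++ plug ρ p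

plug-∷ : ∀ ρ i p → plug ρ (i ∷ p) ≡ ρ i ++ plug ρ p
plug-∷ ρ i [] = sym (++-identityʳ (ρ i))
plug-∷ ρ i (_ ∷ _) = refl

plug-↭ : ∀ ρ {p q} → p ↭ q → plug ρ p ↭ plug ρ q
plug-↭ ρ refl = refl
plug-↭ ρ (prep {p} {q} i r) rewrite plug-∷ ρ i p | plug-∷ ρ i q = ++⁺ˡ (ρ i) (plug-↭ ρ r)
plug-↭ ρ (swap {p} {q} i j r)
  rewrite plug-∷ ρ j p | plug-∷ ρ i q =
  ↭-trans (++⁺ˡ (ρ i) (++⁺ˡ (ρ j) (plug-↭ ρ r))) (shifts (ρ i) (ρ j))
plug-↭ ρ (↭-compose r s) = ↭-trans (plug-↭ ρ r) (plug-↭ ρ s)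

-- For patterns given by numerals both sides evaluate and `refl` proves the hypothesis, whatever the
-- blocks contain. The Gauss conditions of the moves are settled in this way.
sort≡⇒↭ : ∀ {p q} → sort p ≡ sort q → p ↭ q
sort≡⇒↭ {p} {q} eq = ↭-trans (↭-sym (sort-↭ p)) (↭-trans (↭-reflexive eq) (sort-↭ q))

rearrange : ∀ ρ p q → sort p ≡ sort q → plug ρ p ↭ plug ρ q
rearrange ρ p q eq = plug-↭ ρ (sort≡⇒↭ {p} {q} eq)

∈-plug⁺ : ∀ {a} ρ {i p} → i ∈ p → a ∈ ρ i → a ∈ plug ρ p
∈-plug⁺ ρ {p = j ∷ p} i∈ a∈ rewrite plug-∷ ρ j p with i∈
... | here refl  = ∈-++⁺ˡ a∈
... | there i∈p = ∈-++⁺ʳ (ρ j) (∈-plug⁺ ρ i∈p a∈)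

∈-plug⁻ : ∀ {a} ρ p → a ∈ plug ρ p → ∃ λ i → i ∈ p × a ∈ ρ i
∈-plug⁻ ρ (j ∷ p) a∈ rewrite plug-∷ ρ j p with ∈-++⁻ (ρ j) a∈
... | inj₁ a∈j = j , here refl , a∈j
... | inj₂ a∈p with ∈-plug⁻ ρ p a∈p
...   | i , i∈p , a∈i = i , there i∈p , a∈i

map-plug : ∀ f ρ p → map f (plug ρ p) ≡ plug (map f ∘ ρ) p
map-plug f ρ [] = refl
map-plug f ρ (i ∷ p) = begin
  map f (plug ρ (i ∷ p))             ≡⟨ cong (map f) (plug-∷ ρ i p) ⟩
  map f (ρ i ++ plug ρ p)            ≡⟨ map-++ f (ρ i) (plug ρ p) ⟩
  map f (ρ i) ++ map f (plug ρ p)    ≡⟨ cong (map f (ρ i) ++_) (map-plug f ρ p) ⟩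
  map f (ρ i) ++ plug (map f ∘ ρ) p  ≡⟨ plug-∷ (map f ∘ ρ) i p ⟨
  plug (map f ∘ ρ) (i ∷ p)           ∎
  where open ≡-Reasoning

plug-cong : ∀ {ρ ρ′} → (∀ i → ρ i ≡ ρ′ i) → ∀ p → plug ρ p ≡ plug ρ′ p
plug-cong eq [] = refl
plug-cong eq (i ∷ []) = eq i
plug-cong eq (i ∷ p@(_ ∷ _)) = cong₂ _++_ (eq i) (plug-cong eq p)

frame-map : ∀ f bs i → map f (frame bs i) ≡ frame (map (map f) bs) i
frame-map f [] i = refl
frame-map f (b ∷ bs) zero = refl
frame-map f (b ∷ bs) (suc i) = frame-map f bs i

map-plug-frame : ∀ f bs p → map f (plug (frame bs) p) ≡ plug (frame (map (map f) bs)) p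
map-plug-frame f bs p =
  trans (map-plug f (frame bs) p) (plug-cong (frame-map f bs) p)

frame-beyond : ∀ bs {i} → length bs ≤ i → frame bs i ≡ []
frame-beyond [] _ = refl
frame-beyond (b ∷ bs) (s≤s l) = frame-beyond bs l

infixl 6 _∖_

_∖_ : Word → ℕ → Word
w ∖ a = filter (λ b → ¬? (a ≟ b)) w

-- Once both copies of `A` are moved to the front, the rest of a Gauss word is free of `A`. The test
-- `covered` ensures that every block other than `k` occurs in that rest; indices past the end of
-- `bs` denote empty blocks.
separated : ∀ bs w {A} k → {True (All.all? (_∈? (k ∷ w ∖ k)) (upTo (length bs)))} →
            frame bs k ≡ [ A ] → sort w ≡ sort (k ∷ k ∷ w ∖ k) → IsGauss (plug (frame bs) w) →
            ∀ i → i ≢ k → A ∉ frame bs i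
separated bs w {A} k {covered} eq perm g i i≢k A∈i with i ∈? w ∖ k
... | yes i∈ = IsGauss-fresh {A} {plug (frame bs) (w ∖ k)}
        (subst IsGauss split (IsGauss-↭ (rearrange (frame bs) w (k ∷ k ∷ w ∖ k) perm) g))
        (∈-plug⁺ (frame bs) i∈ A∈i)
  where
  split : plug (frame bs) (k ∷ k ∷ w ∖ k) ≡ A ∷ A ∷ plug (frame bs) (w ∖ k)
  split rewrite plug-∷ (frame bs) k (w ∖ k) | eq = refl
... | no i∉ with subst (A ∈_) (frame-beyond bs (≮⇒≥ beyond)) A∈i
  where
  beyond : ¬ i < length bs
  beyond i<n with All.lookup (toWitness covered) (∈-upTo⁺ i<n)
  ... | here i≡k = i≢k i≡k
  ... | there i∈ = i∉ i∈
... | ()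

-- Derived moves

plug-++ : ∀ ρ p q → plug ρ (p ++ q) ≡ plug ρ p ++ plug ρ q
plug-++ ρ [] q = refl
plug-++ ρ (i ∷ p) q
  rewrite plug-∷ ρ i (p ++ q) | plug-∷ ρ i p | plug-++ ρ p q = sym (++-assoc (ρ i) _ _)

plug-double : ∀ ρ {i A} q → ρ i ≡ [ A ] → plug ρ (i ∷ i ∷ q) ≡ A ∷ A ∷ plug ρ q
plug-double ρ {i} q eqA rewrite plug-∷ ρ i q | eqA = refl

plug-letters : ∀ ρ p {i j A B} q → ρ i ≡ [ A ] → ρ j ≡ [ B ] →
               plug ρ (p ++ i ∷ j ∷ q) ≡ plug ρ p ++ A ∷ B ∷ plug ρ q
plug-letters ρ p {i} {j} q eqA eqB
  rewrite plug-++ ρ p (i ∷ j ∷ q) | plug-∷ ρ j q | eqA | eqB = refl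

gauss-rearrange : ∀ ρ {p} q → sort p ≡ sort q → IsGauss (plug ρ p) → IsGauss (plug ρ q)
gauss-rearrange ρ {p} q eq = IsGauss-↭ (rearrange ρ p q eq)

gauss-cancel : ∀ ρ {p A} i q → ρ i ≡ [ A ] → sort p ≡ sort (i ∷ i ∷ q) → IsGauss (plug ρ p) → IsGauss (plug ρ q)
gauss-cancel ρ {p} {A} i q eqA eq g =
  IsGauss-delete {A} (subst IsGauss (plug-double ρ q eqA) (gauss-rearrange ρ {p} (i ∷ i ∷ q) eq g))

replace : ℕ → ℕ → ℕ → ℕ
replace a b c with c ≟ a
... | yes _ = b
... | no _  = c

replace-self : ∀ a b → replace a b a ≡ b
replace-self a b with a ≟ a
... | yes _  = refl
... | no a≢a = contradiction refl a≢a

replace-other : ∀ {a} b {c} → c ≢ a → replace a b c ≡ c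
replace-other {a} b {c} c≢a with c ≟ a
... | yes c≡a = contradiction c≡a c≢a
... | no _    = refl

replace-injective : ∀ {a b w} → b ∉ w → ∀ c d → c ∈ w → d ∈ w →
                    replace a b c ≡ replace a b d → c ≡ d
replace-injective {a} b∉w c d c∈ d∈ eq with c ≟ a | d ≟ a
... | yes c≡a | yes d≡a = trans c≡a (sym d≡a)
... | yes _   | no _    = contradiction (subst (_∈ _) (sym eq) d∈) b∉w
... | no _    | yes _   = contradiction (subst (_∈ _) eq c∈) b∉w
... | no _    | no _    = eq

plug-reindex : ∀ ρ (σ : ℕ → ℕ) p → plug ρ (map σ p) ≡ plug (ρ ∘ σ) p
plug-reindex ρ σ [] = refl
plug-reindex ρ σ (i ∷ []) = refl
plug-reindex ρ σ (i ∷ p@(_ ∷ _)) = cong (ρ (σ i) ++_) (plug-reindex ρ σ p)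

map-replace : ∀ ρ {k l A B} → ρ k ≡ [ A ] → ρ l ≡ [ B ] →
              (∀ i → i ≢ k → A ∉ ρ i) → ∀ p →
              map (replace A B) (plug ρ p) ≡ plug ρ (map (replace k l) p)
map-replace ρ {k} {l} {A} {B} eqA eqB A∉ p = begin
  map (replace A B) (plug ρ p)     ≡⟨ map-plug (replace A B) ρ p ⟩
  plug (map (replace A B) ∘ ρ) p   ≡⟨ plug-cong block p ⟩
  plug (ρ ∘ replace k l) p         ≡⟨ plug-reindex ρ (replace k l) p ⟨
  plug ρ (map (replace k l) p)     ∎
  where
  open ≡-Reasoning
  block : ∀ i → map (replace A B) (ρ i) ≡ ρ (replace k l i)
  block i with i ≟ k
  ... | yes refl rewrite eqA | replace-self A B = sym eqB
  ... | no i≢k = map-id-local (All.tabulate λ {a} a∈ →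
          replace-other B λ { refl → A∉ i i≢k a∈ })

∉-plug : ∀ {A} ρ {k} p → (∀ i → i ≢ k → A ∉ ρ i) → k ∉ p → A ∉ plug ρ p
∉-plug ρ p A∉ k∉p A∈ with ∈-plug⁻ ρ p A∈
... | i , i∈p , A∈i = A∉ i (λ { refl → k∉p i∈p }) A∈i

fresh : Word → ℕ
fresh w = suc (sum w)

fresh-< : ∀ w {a} → a ∈ w → a < fresh w
fresh-< (b ∷ w) (here refl) = s≤s (m≤m+n b (sum w))
fresh-< (b ∷ w) (there a∈w) = ≤-trans (fresh-< w a∈w) (s≤s (m≤n+m (sum w) b))

fresh-∉ : ∀ w → fresh w ∉ w
fresh-∉ w a∈w = 1+n≰n (fresh-< w a∈w)

suc-fresh-∉ : ∀ w → suc (fresh w) ∉ fresh w ∷ fresh w ∷ w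
suc-fresh-∉ w (here eq) = 1+n≢n eq
suc-fresh-∉ w (there (here eq)) = 1+n≢n eq
suc-fresh-∉ w (there (there a∈w)) = 1+n≰n (≤-trans (n≤1+n _) (fresh-< w a∈w))

IsGauss-fresh₂ : ∀ w → IsGauss w → IsGauss (suc (fresh w) ∷ suc (fresh w) ∷ fresh w ∷ fresh w ∷ w)
IsGauss-fresh₂ w g = IsGauss-insert (suc-fresh-∉ w) (IsGauss-insert (fresh-∉ w) g)

-- One Gauss word serves a whole chain of moves: the other words of the chain arise from it by
-- permuting blocks and cancelling letters, so that all side conditions follow from `gw`.
module Moves (bs : List Word) (w : List ℕ) (gw : IsGauss (plug (frame bs) w)) where

  ρ : ℕ → Word
  ρ = frame bs

  gauss : ∀ q → sort w ≡ sort q → IsGauss (plug ρ q)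
  gauss q eq = gauss-rearrange ρ {w} q eq gw

  plug-H1 : ∀ p q i {A} → ρ i ≡ [ A ] →
            sort w ≡ sort (p ++ i ∷ i ∷ q) → sort w ≡ sort (i ∷ i ∷ p ++ q) →
            Homotopic (plug ρ (p ++ i ∷ i ∷ q)) (plug ρ (p ++ q))
  plug-H1 p q i eqA eq eq′
    with gauss (p ++ i ∷ i ∷ q) eq | gauss-cancel ρ {w} i (p ++ q) eqA eq′ gw
  ... | g | h rewrite plug-letters ρ p q eqA eqA | plug-++ ρ p q = h-move (H1 _ _ _ g h)

  plug-H2 : ∀ p q r i j {A B} → ρ i ≡ [ A ] → ρ j ≡ [ B ] →
            sort w ≡ sort (p ++ i ∷ j ∷ q ++ j ∷ i ∷ r) → sort w ≡ sort (i ∷ i ∷ j ∷ j ∷ p ++ q ++ r) →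
            Homotopic (plug ρ (p ++ i ∷ j ∷ q ++ j ∷ i ∷ r)) (plug ρ (p ++ q ++ r))
  plug-H2 p q r i j eqA eqB eq eq′
    with gauss (p ++ i ∷ j ∷ q ++ j ∷ i ∷ r) eq
       | gauss-cancel ρ {j ∷ j ∷ p ++ q ++ r} j (p ++ q ++ r) eqB refl
           (gauss-cancel ρ {w} i (j ∷ j ∷ p ++ q ++ r) eqA eq′ gw)
  ... | g | h
    rewrite plug-letters ρ p (q ++ j ∷ i ∷ r) eqA eqB | plug-letters ρ q r eqB eqA
          | plug-++ ρ p (q ++ r) | plug-++ ρ q r = h-move (H2 _ _ _ _ _ g h)

  plug-H3 : ∀ p q r s i j k {A B C} → ρ i ≡ [ A ] → ρ j ≡ [ B ] → ρ k ≡ [ C ] →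
            sort w ≡ sort (p ++ i ∷ j ∷ q ++ i ∷ k ∷ r ++ j ∷ k ∷ s) →
            sort w ≡ sort (p ++ j ∷ i ∷ q ++ k ∷ i ∷ r ++ k ∷ j ∷ s) →
            Homotopic (plug ρ (p ++ i ∷ j ∷ q ++ i ∷ k ∷ r ++ j ∷ k ∷ s))
                      (plug ρ (p ++ j ∷ i ∷ q ++ k ∷ i ∷ r ++ k ∷ j ∷ s))
  plug-H3 p q r s i j k eqA eqB eqC eq eq′
    with gauss (p ++ i ∷ j ∷ q ++ i ∷ k ∷ r ++ j ∷ k ∷ s) eq
       | gauss (p ++ j ∷ i ∷ q ++ k ∷ i ∷ r ++ k ∷ j ∷ s) eq′
  ... | g | h
    rewrite plug-letters ρ p (q ++ i ∷ k ∷ r ++ j ∷ k ∷ s) eqA eqB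
          | plug-letters ρ q (r ++ j ∷ k ∷ s) eqA eqC
          | plug-letters ρ r s eqB eqC
          | plug-letters ρ p (q ++ k ∷ i ∷ r ++ k ∷ j ∷ s) eqB eqA
          | plug-letters ρ q (r ++ k ∷ j ∷ s) eqC eqA
          | plug-letters ρ r s eqC eqB = h-move (H3 _ _ _ _ _ _ _ g h)

  -- Used when a chain has cancelled the letters of blocks `l` and `m` against each other: the
  -- letter of block `k`, introduced as an auxiliary one, takes over the name freed by `l`. The
  -- renaming is injective because that name no longer occurs.
  rename : ∀ k l m p {A B C} →
           {True (All.all? (_∈? (k ∷ w ∖ k)) (upTo (length bs)))} →
           {True (All.all? (_∈? (l ∷ w ∖ l)) (upTo (length bs)))} → {False (l ∈? p)} →
           ρ k ≡ [ A ] → ρ l ≡ [ B ] → ρ m ≡ [ C ] →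
           sort w ≡ sort (k ∷ k ∷ w ∖ k) → sort w ≡ sort (l ∷ l ∷ w ∖ l) →
           sort w ≡ sort (l ∷ l ∷ m ∷ m ∷ p) →
           Homotopic (plug ρ p) (plug ρ (map (replace k l) p))
  rename k l m p {A} {B} {_} {ck} {cl} {l∉p} eqA eqB eqC ek el ep = h-iso
    (gauss-cancel ρ {m ∷ m ∷ p} m p eqC refl (gauss-cancel ρ {w} l (m ∷ m ∷ p) eqB ep gw))
    (replace A B ,
     replace-injective (∉-plug ρ p (separated bs w l {cl} eqB el gw) (toWitnessFalse l∉p)) ,
     map-replace ρ eqA eqB (separated bs w k {ck} eqA ek gw) p)

-- New letters D (block 7) and E (block 8) make (H3) applicable to E, A, C; afterwards E
-- cancels against B, and D takes over the role of B.  The other two slides are similar.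
slide-CA-BC : ∀ x y z t A B C → IsGauss (x ++ A ∷ B ∷ y ++ C ∷ A ∷ z ++ B ∷ C ∷ t) →
  Homotopic (x ++ A ∷ B ∷ y ++ C ∷ A ∷ z ++ B ∷ C ∷ t) (x ++ B ∷ A ∷ y ++ A ∷ C ∷ z ++ C ∷ B ∷ t)
slide-CA-BC x y z t A B C g =
  h-trans (h-sym (plug-H2 (3 ∷ []) (0 ∷ 1 ∷ 4 ∷ 2 ∷ 0 ∷ 5 ∷ 1 ∷ 2 ∷ []) (6 ∷ []) 7 8 refl refl refl refl)) (
  h-trans (h-sym (plug-H3 (3 ∷ 7 ∷ []) (1 ∷ 4 ∷ []) (5 ∷ 1 ∷ []) (7 ∷ 6 ∷ []) 0 8 2 refl refl refl refl refl)) (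
  h-trans (plug-H2 (3 ∷ 7 ∷ 0 ∷ []) (4 ∷ 0 ∷ 2 ∷ 5 ∷ []) (2 ∷ 7 ∷ 6 ∷ []) 8 1 refl refl refl refl)
  (rename 7 1 8 (3 ∷ 7 ∷ 0 ∷ 4 ∷ 0 ∷ 2 ∷ 5 ∷ 2 ∷ 7 ∷ 6 ∷ []) refl refl refl refl refl refl)))
  where
  W : Word
  W = x ++ A ∷ B ∷ y ++ C ∷ A ∷ z ++ B ∷ C ∷ t
  open Moves ([ A ] ∷ [ B ] ∷ [ C ] ∷ x ∷ y ∷ z ∷ t ∷ [ fresh W ] ∷ [ suc (fresh W) ] ∷ [])
             (8 ∷ 8 ∷ 7 ∷ 7 ∷ 3 ∷ 0 ∷ 1 ∷ 4 ∷ 2 ∷ 0 ∷ 5 ∷ 1 ∷ 2 ∷ 6 ∷ []) (IsGauss-fresh₂ W g)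

-- New letters E and F are inserted around the first A B, giving x E F A B F E y A B z. Sliding F,
-- A, B turns this into x E A F F B E y B A z: the copies of F have met and the second A B is
-- reversed. Now F, then A with B, then E cancel by the original moves.
parallel-H2 : ∀ x y z A B → IsGauss (x ++ A ∷ B ∷ y ++ A ∷ B ∷ z) →
  Homotopic (x ++ A ∷ B ∷ y ++ A ∷ B ∷ z) (x ++ y ++ z)
parallel-H2 x y z A B g =
  h-trans (h-sym (plug-H2 (2 ∷ []) (0 ∷ 1 ∷ []) (3 ∷ 0 ∷ 1 ∷ 4 ∷ []) 6 5 refl refl refl refl)) (
  h-trans (subst₂ Homotopic (++-assoc x _ _) (++-assoc x _ _)
    (slide-CA-BC (x ++ [ E₀ ]) [] (E₀ ∷ y) z F₀ A B (subst IsGauss (sym (++-assoc x _ _))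
      (gauss (2 ∷ 6 ∷ 5 ∷ 0 ∷ 1 ∷ 5 ∷ 6 ∷ 3 ∷ 0 ∷ 1 ∷ 4 ∷ []) refl)))) (
  h-trans (plug-H1 (2 ∷ 6 ∷ 0 ∷ []) (1 ∷ 6 ∷ 3 ∷ 1 ∷ 0 ∷ 4 ∷ []) 5 refl refl refl) (
  h-trans (Without-F.plug-H2 (2 ∷ 6 ∷ []) (6 ∷ 3 ∷ []) (4 ∷ []) 0 1 refl refl refl refl)
  (Only-E.plug-H1 (2 ∷ []) (3 ∷ 4 ∷ []) 6 refl refl refl))))
  where
  W : Word
  W = x ++ A ∷ B ∷ y ++ A ∷ B ∷ z
  F₀ E₀ : ℕ
  F₀ = fresh W
  E₀ = suc F₀
  bs : List Word
  bs = [ A ] ∷ [ B ] ∷ x ∷ y ∷ z ∷ [ F₀ ] ∷ [ E₀ ] ∷ []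
  open Moves bs (6 ∷ 6 ∷ 5 ∷ 5 ∷ 2 ∷ 0 ∷ 1 ∷ 3 ∷ 0 ∷ 1 ∷ 4 ∷ []) (IsGauss-fresh₂ W g)
  g₁ : IsGauss (plug ρ (6 ∷ 6 ∷ 2 ∷ 0 ∷ 1 ∷ 3 ∷ 0 ∷ 1 ∷ 4 ∷ []))
  g₁ = gauss-cancel ρ {5 ∷ 5 ∷ 6 ∷ 6 ∷ 2 ∷ 0 ∷ 1 ∷ 3 ∷ 0 ∷ 1 ∷ 4 ∷ []} 5 (6 ∷ 6 ∷ 2 ∷ 0 ∷ 1 ∷ 3 ∷ 0 ∷ 1 ∷ 4 ∷ []) refl refl
         (gauss (5 ∷ 5 ∷ 6 ∷ 6 ∷ 2 ∷ 0 ∷ 1 ∷ 3 ∷ 0 ∷ 1 ∷ 4 ∷ []) refl)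
  g₂ : IsGauss (plug ρ (6 ∷ 6 ∷ 2 ∷ 3 ∷ 4 ∷ []))
  g₂ = gauss-cancel ρ {1 ∷ 1 ∷ 6 ∷ 6 ∷ 2 ∷ 3 ∷ 4 ∷ []} 1 (6 ∷ 6 ∷ 2 ∷ 3 ∷ 4 ∷ []) refl refl
         (gauss-cancel ρ {6 ∷ 6 ∷ 2 ∷ 0 ∷ 1 ∷ 3 ∷ 0 ∷ 1 ∷ 4 ∷ []} 0 (1 ∷ 1 ∷ 6 ∷ 6 ∷ 2 ∷ 3 ∷ 4 ∷ []) refl refl g₁)
  -- A `Moves` module fixes which letters are present, so the chain continues in a new one after
  -- each cancellation.
  module Without-F = Moves bs (6 ∷ 6 ∷ 2 ∷ 0 ∷ 1 ∷ 3 ∷ 0 ∷ 1 ∷ 4 ∷ []) g₁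
  module Only-E = Moves bs (6 ∷ 6 ∷ 2 ∷ 3 ∷ 4 ∷ []) g₂

module ParallelMoves (bs : List Word) (w : List ℕ) (gw : IsGauss (plug (frame bs) w)) where
  open Moves bs w gw public

  plug-parallel-H2 : ∀ p q r i j {A B} → ρ i ≡ [ A ] → ρ j ≡ [ B ] →
                     sort w ≡ sort (p ++ i ∷ j ∷ q ++ i ∷ j ∷ r) →
                     Homotopic (plug ρ (p ++ i ∷ j ∷ q ++ i ∷ j ∷ r)) (plug ρ (p ++ q ++ r))
  plug-parallel-H2 p q r i j eqA eqB eq with gauss (p ++ i ∷ j ∷ q ++ i ∷ j ∷ r) eq
  ... | g rewrite plug-letters ρ p (q ++ i ∷ j ∷ r) eqA eqB | plug-letters ρ q r eqA eqB
                | plug-++ ρ p (q ++ r) | plug-++ ρ q r = parallel-H2 _ _ _ _ _ g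

slide-CA-CB : ∀ x y z t A B C → IsGauss (x ++ A ∷ B ∷ y ++ C ∷ A ∷ z ++ C ∷ B ∷ t) →
  Homotopic (x ++ A ∷ B ∷ y ++ C ∷ A ∷ z ++ C ∷ B ∷ t) (x ++ B ∷ A ∷ y ++ A ∷ C ∷ z ++ B ∷ C ∷ t)
slide-CA-CB x y z t A B C g =
  h-trans (h-sym (plug-parallel-H2 (3 ∷ 0 ∷ 1 ∷ 4 ∷ 2 ∷ 0 ∷ []) (5 ∷ 2 ∷ 1 ∷ []) (6 ∷ []) 7 8 refl refl refl)) (
  h-trans (plug-H3 (3 ∷ []) (4 ∷ 2 ∷ []) (8 ∷ 5 ∷ 2 ∷ []) (8 ∷ 6 ∷ []) 0 1 7 refl refl refl refl refl) (
  h-trans (plug-parallel-H2 (3 ∷ 1 ∷ 0 ∷ 4 ∷ []) (0 ∷ 8 ∷ 5 ∷ []) (1 ∷ 8 ∷ 6 ∷ []) 2 7 refl refl refl)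
  (rename 8 2 7 (3 ∷ 1 ∷ 0 ∷ 4 ∷ 0 ∷ 8 ∷ 5 ∷ 1 ∷ 8 ∷ 6 ∷ []) refl refl refl refl refl refl)))
  where
  W : Word
  W = x ++ A ∷ B ∷ y ++ C ∷ A ∷ z ++ C ∷ B ∷ t
  open ParallelMoves ([ A ] ∷ [ B ] ∷ [ C ] ∷ x ∷ y ∷ z ∷ t ∷ [ fresh W ] ∷ [ suc (fresh W) ] ∷ [])
                     (8 ∷ 8 ∷ 7 ∷ 7 ∷ 3 ∷ 0 ∷ 1 ∷ 4 ∷ 2 ∷ 0 ∷ 5 ∷ 2 ∷ 1 ∷ 6 ∷ []) (IsGauss-fresh₂ W g)

slide-AC-CB : ∀ x y z t A B C → IsGauss (x ++ A ∷ B ∷ y ++ A ∷ C ∷ z ++ C ∷ B ∷ t) →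
  Homotopic (x ++ A ∷ B ∷ y ++ A ∷ C ∷ z ++ C ∷ B ∷ t) (x ++ B ∷ A ∷ y ++ C ∷ A ∷ z ++ B ∷ C ∷ t)
slide-AC-CB x y z t A B C g =
  h-trans (h-sym (plug-parallel-H2 (3 ∷ 0 ∷ 1 ∷ []) (4 ∷ 0 ∷ 2 ∷ []) (5 ∷ 2 ∷ 1 ∷ 6 ∷ []) 7 8 refl refl refl)) (
  h-trans (h-sym (plug-H3 (3 ∷ 0 ∷ []) (8 ∷ 4 ∷ 0 ∷ []) (8 ∷ 5 ∷ []) (6 ∷ []) 7 1 2 refl refl refl refl refl)) (
  h-trans (plug-parallel-H2 (3 ∷ []) (1 ∷ 8 ∷ 4 ∷ []) (2 ∷ 8 ∷ 5 ∷ 1 ∷ 2 ∷ 6 ∷ []) 0 7 refl refl refl)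
  (rename 8 0 7 (3 ∷ 1 ∷ 8 ∷ 4 ∷ 2 ∷ 8 ∷ 5 ∷ 1 ∷ 2 ∷ 6 ∷ []) refl refl refl refl refl refl)))
  where
  W : Word
  W = x ++ A ∷ B ∷ y ++ A ∷ C ∷ z ++ C ∷ B ∷ t
  open ParallelMoves ([ A ] ∷ [ B ] ∷ [ C ] ∷ x ∷ y ∷ z ∷ t ∷ [ fresh W ] ∷ [ suc (fresh W) ] ∷ [])
                     (8 ∷ 8 ∷ 7 ∷ 7 ∷ 3 ∷ 0 ∷ 1 ∷ 4 ∷ 0 ∷ 2 ∷ 5 ∷ 2 ∷ 1 ∷ 6 ∷ []) (IsGauss-fresh₂ W g)

-- Searching for homotopies

when : ∀ {P X : Set} → Dec P → (P → List X) → List X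
when (yes p) f = f p
when (no _)  f = []

record Pair (w : Word) : Set where
  constructor cut
  field
    before  : Word
    fst snd : ℕ
    after   : Word
    eq      : w ≡ before ++ fst ∷ snd ∷ after

adjacent : ∀ w → List (Pair w)
adjacent [] = []
adjacent (_ ∷ []) = []
adjacent (a ∷ b ∷ w) = cut [] a b w refl ∷ map extend (adjacent (b ∷ w))
  where
  extend : Pair (b ∷ w) → Pair (a ∷ b ∷ w)
  extend (cut x c d y eq) = cut (a ∷ x) c d y (cong (a ∷_) eq)

Reducible : Word → Set
Reducible w = Σ Word λ v → IsGauss v × rank v ≤ 4 × Homotopic w v

reduction : ∀ {w v} → IsGauss v → Homotopic w v → List (Reducible w)
reduction {v = v} g h = when (rank v ≤? 4) λ r → [ v , g , r , h ]

reductions : ∀ w → IsGauss w → List (Reducible w)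
reductions w gw = concatMap (at₁ gw) (adjacent w)
  where
  -- The word is a variable here, so that the equation stored in a cut can be matched with `refl`.
  at₂ : ∀ {w x A B u} → IsGauss w → w ≡ x ++ A ∷ B ∷ u → Pair u → List (Reducible w)
  at₂ {x = x} {A} {B} g refl (cut y C D z refl) =
    when (C ≟ B) (λ { refl → when (D ≟ A) λ { refl →
      reduction (cancel₂ (2 ∷ 0 ∷ 1 ∷ 3 ∷ 1 ∷ 0 ∷ 4 ∷ []) refl g) (h-move (H2 x y z A B g (cancel₂ (2 ∷ 0 ∷ 1 ∷ 3 ∷ 1 ∷ 0 ∷ 4 ∷ []) refl g))) } }) ++
    when (C ≟ A) (λ { refl → when (D ≟ B) λ { refl →
      reduction (cancel₂ (2 ∷ 0 ∷ 1 ∷ 3 ∷ 0 ∷ 1 ∷ 4 ∷ []) refl g) (parallel-H2 x y z A B g) } })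
    where
    ρ : ℕ → Word
    ρ = frame ([ A ] ∷ [ B ] ∷ x ∷ y ∷ z ∷ [])
    cancel₂ : ∀ p → _ → IsGauss (plug ρ p) → IsGauss (x ++ y ++ z)
    cancel₂ p eq h = gauss-cancel ρ {1 ∷ 1 ∷ 2 ∷ 3 ∷ 4 ∷ []} 1 (2 ∷ 3 ∷ 4 ∷ []) refl refl
      (gauss-cancel ρ {p} 0 (1 ∷ 1 ∷ 2 ∷ 3 ∷ 4 ∷ []) refl eq h)
  at₁ : ∀ {w} → IsGauss w → Pair w → List (Reducible w)
  at₁ g (cut x A B u refl) =
    when (A ≟ B) (λ { refl →
      let h = gauss-cancel (frame ([ A ] ∷ x ∷ u ∷ [])) {1 ∷ 0 ∷ 0 ∷ 2 ∷ []} 0 (1 ∷ 2 ∷ []) refl refl g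
      in reduction h (h-move (H1 x u A g h)) }) ++
    concatMap (at₂ g refl) (adjacent u)

Reachable : Word → Set
Reachable w = Σ Word λ v → IsGauss v × Homotopic w v

-- All versions of (H3) and their inverses have the same effect: three letters, paired two at a time
-- in disjoint adjacent pairs, change places within each pair. Given the first pair A B, there are
-- eight arrangements of the other two pairs, and each is one side of exactly one version.
slides : ∀ w → IsGauss w → List (Reachable w)
slides w gw = concatMap (at₁ gw) (adjacent w)
  where
  at₃ : ∀ {w x A B y C D u} → IsGauss w → w ≡ x ++ A ∷ B ∷ y ++ C ∷ D ∷ u → Pair u → List (Reachable w)
  at₃ {x = x} {A} {B} {y} {C} {D} g refl (cut z E F t refl) =
    when (C ≟ A) (λ { refl →
      when (E ≟ B) (λ { refl → when (F ≟ D) λ { refl → [ w′ , to , h-move (H3 x y z t A B D g to) ] } }) ++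
      when (E ≟ D) (λ { refl → when (F ≟ B) λ { refl → [ w′ , to , slide-AC-CB x y z t A B D g ] } }) }) ++
    when (D ≟ A) (λ { refl →
      when (E ≟ B) (λ { refl → when (F ≟ C) λ { refl → [ w′ , to , slide-CA-BC x y z t A B C g ] } }) ++
      when (E ≟ C) (λ { refl → when (F ≟ B) λ { refl → [ w′ , to , slide-CA-CB x y z t A B C g ] } }) }) ++
    when (C ≟ B) (λ { refl →
      when (E ≟ A) (λ { refl → when (F ≟ D) λ { refl → [ w′ , to , h-sym (slide-CA-CB x y z t B A D to) ] } }) ++
      when (E ≟ D) (λ { refl → when (F ≟ A) λ { refl → [ w′ , to , h-sym (slide-CA-BC x y z t B A D to) ] } }) }) ++
    when (D ≟ B) (λ { refl →
      when (E ≟ A) (λ { refl → when (F ≟ C) λ { refl → [ w′ , to , h-sym (slide-AC-CB x y z t B A C to) ] } }) ++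
      when (E ≟ C) (λ { refl → when (F ≟ A) λ { refl → [ w′ , to , h-sym (h-move (H3 x y z t B A C to g)) ] } }) })
    where
    w′ : Word
    w′ = x ++ B ∷ A ∷ y ++ D ∷ C ∷ z ++ F ∷ E ∷ t
    to : IsGauss w′
    to = gauss-rearrange
      (frame (x ∷ [ A ] ∷ [ B ] ∷ y ∷ [ C ] ∷ [ D ] ∷ z ∷ [ E ] ∷ [ F ] ∷ t ∷ []))
      {upTo 10} (0 ∷ 2 ∷ 1 ∷ 3 ∷ 5 ∷ 4 ∷ 6 ∷ 8 ∷ 7 ∷ 9 ∷ []) refl g
  at₂ : ∀ {w x A B u} → IsGauss w → w ≡ x ++ A ∷ B ∷ u → Pair u → List (Reachable w)
  at₂ {x = x} {A} {B} g refl (cut y C D u refl) =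
    concatMap (at₃ {x = x} {A} {B} {y} {C} {D} g refl) (adjacent u)
  at₁ : ∀ {w} → IsGauss w → Pair w → List (Reachable w)
  at₁ g (cut x A B u refl) = concatMap (at₂ {x = x} g refl) (adjacent u)

extend : ∀ {u v} → Homotopic u v → Reachable v → Reachable u
extend h (v , g , k) = v , g , h-trans h k

reach : ℕ → ∀ w → IsGauss w → List (Reachable w)
reach zero w g = [ w , g , h-refl ]
reach (suc n) w g =
  (w , g , h-refl) ∷ concatMap (λ { (v , gv , h) → map (extend h) (reach n v gv) }) (slides w g)

-- Splittings of words and normal forms under isomorphism

splits : Word → List (Word × Word)
splits [] = [ [] , [] ]
splits (a ∷ w) = ([] , a ∷ w) ∷ map (λ { (x , y) → a ∷ x , y }) (splits w)

∈-splits : ∀ x y → (x , y) ∈ splits (x ++ y)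
∈-splits [] [] = here refl
∈-splits [] (_ ∷ _) = here refl
∈-splits (a ∷ x) y = there (∈-map⁺ _ (∈-splits x y))

firstIndex : ℕ → Word → ℕ
firstIndex a [] = 0
firstIndex a (b ∷ w) with a ≟ b
... | yes _ = 0
... | no _  = suc (firstIndex a w)

firstIndex-injective : ∀ {a b} w → a ∈ w → b ∈ w → firstIndex a w ≡ firstIndex b w → a ≡ b
firstIndex-injective {a} {b} (c ∷ w) a∈ b∈ eq with a ≟ c | b ≟ c
firstIndex-injective (c ∷ w) a∈ b∈ eq | yes refl | yes refl = refl
firstIndex-injective (c ∷ w) (here a≡c) b∈ eq | no a≢c | no _ = contradiction a≡c a≢c
firstIndex-injective (c ∷ w) (there _) (here b≡c) eq | no _ | no b≢c = contradiction b≡c b≢c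
firstIndex-injective (c ∷ w) (there a∈) (there b∈) eq | no _ | no _ =
  firstIndex-injective w a∈ b∈ (suc-injective eq)

-- Letters become 0, 1, 2, ... in the order of their first occurrence, which is how the words of the
-- table are written. Isomorphism to a word of the table thus turns into membership.
normalise : Word → Word
normalise w = map (λ a → firstIndex a (deduplicate _≟_ w)) w

Iso-normalise : ∀ w → Iso w (normalise w)
Iso-normalise w = (λ a → firstIndex a (deduplicate _≟_ w)) ,
  (λ a b a∈ b∈ → firstIndex-injective (deduplicate _≟_ w) (∈-deduplicate⁺ _≟_ a∈) (∈-deduplicate⁺ _≟_ b∈)) , refl

Iso-trans : ∀ {u v w} → Iso u v → Iso v w → Iso u w
Iso-trans {u} (f , f-inj , refl) (g , g-inj , refl) =
  g ∘ f , (λ a b a∈ b∈ eq → f-inj a b a∈ b∈ (g-inj (f a) (f b) (∈-map⁺ f a∈) (∈-map⁺ f b∈) eq)) , map-∘ u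

normalise≡⇒Homotopic : ∀ {u v} → IsGauss u → IsGauss v → normalise u ≡ normalise v → Homotopic u v
normalise≡⇒Homotopic {u} {v} gu gv eq =
  h-trans (h-iso gu (Iso-normalise u)) (h-sym (subst (Homotopic v) (sym eq) (h-iso gv (Iso-normalise v))))

_≟ʷ_ : (u v : Word) → Dec (u ≡ v)
_≟ʷ_ = ≡-dec _≟_

IsGauss? : ∀ w → Dec (IsGauss w)
IsGauss? w = map′ (λ h a a∈ → All.lookup h a∈) (λ g → All.tabulate λ {a} → g a) (All.all? (λ a → occ a w ≟ 2) w)

-- Homotopies within the rows and reductions of the words of rank five

linked? : ∀ u v → List (Homotopic u v)
linked? u v = when (IsGauss? u) λ gu → when (IsGauss? v) λ gv →
  -- Up to isomorphism, four slides are enough for all pairs needed in (a).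
  concatMap (λ { (w , gw , h) → when (normalise w ≟ʷ normalise v) λ eq → [ h-trans h (normalise≡⇒Homotopic gw gv eq) ] }) (reach 4 u gu)

-- Asks the type checker for the Boolean alone; the proofs collected by a search remain unevaluated.
decided : ∀ {P : Set} (d : Dec P) → does d ≡ true → P
decided (yes p) _ = p

nonEmpty : ∀ {X : Set} → List X → Bool
nonEmpty [] = false
nonEmpty (_ ∷ _) = true

first : ∀ {X : Set} (xs : List X) → T (nonEmpty xs) → X
first (x ∷ _) _ = x

connected : List Word → Bool
connected [] = true
connected (u ∷ us) = all (λ v → nonEmpty (linked? u v)) us

connected⇒Homotopic : ∀ r → T (connected r) → ∀ {u v} → u ∈ r → v ∈ r → Homotopic u v
connected⇒Homotopic (w ∷ ws) ok u∈ v∈ = h-trans (h-sym (from u∈)) (from v∈)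
  where
  from : ∀ {u} → u ∈ w ∷ ws → Homotopic w u
  from (here refl) = h-refl
  from (there u∈) = first _ (All.lookup (all⁺ _ ws ok) u∈)

nth-All : ∀ {P : List Word → Set} → P [] → ∀ {rs} → All P rs → ∀ i → P (nth i rs)
nth-All p [] i = p
nth-All p (q ∷ qs) zero = q
nth-All p (q ∷ qs) (suc i) = nth-All p qs i

rows-connected : All (T ∘ connected) (drop 2 rowTable)
rows-connected = decided (All.all? (λ r → T? (connected r)) (drop 2 rowTable)) refl

w₁~w₂ : Homotopic w₁ w₂
w₁~w₂ = first (linked? w₁ w₂) tt

w₃~w₄ : Homotopic w₃ w₄
w₃~w₄ = first (linked? w₃ w₄) tt

-- The letters are numbered downwards: the first letter of a word in chords (suc n) is n.
chords : ℕ → List Word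
chords zero = [ [] ]
chords (suc n) = concatMap (λ c → map (λ { (y , z) → n ∷ y ++ n ∷ z }) (splits c)) (chords n)

∈-chords : ∀ n y z → y ++ z ∈ chords n → n ∷ y ++ n ∷ z ∈ chords (suc n)
∈-chords n y z yz∈ = ∈-concatMap⁺ _ {xs = chords n}
  (Any.map (λ { refl → ∈-map⁺ _ (∈-splits y z) }) yz∈)

-- Two lists without repetitions and with the same members are permutations of each other, so their
-- lengths agree.
rank-remove : ∀ A y z → A ∉ y ++ z → rank (A ∷ y ++ A ∷ z) ≡ suc (rank (y ++ z))
rank-remove A y z A∉ = cong suc (↭-length (∼bag⇒↭ (unique∧set⇒bag
  (filter⁺ (λ b → ¬? (A ≟ b)) (deduplicate-! (y ++ A ∷ z))) (deduplicate-! (y ++ z)) (mk⇔ to from))))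
  where
  P? = λ b → ¬? (A ≟ b)
  to : ∀ {b} → b ∈ deduplicate _≟_ (y ++ A ∷ z) ∖ A → b ∈ deduplicate _≟_ (y ++ z)
  to b∈ with ∈-filter⁻ P? {xs = deduplicate _≟_ (y ++ A ∷ z)} b∈
  ... | b∈′ , A≢b with ∈-++⁻ y (∈-deduplicate⁻ _≟_ (y ++ A ∷ z) b∈′)
  ...   | inj₁ b∈y = ∈-deduplicate⁺ _≟_ (∈-++⁺ˡ b∈y)
  ...   | inj₂ (here b≡A) = contradiction (sym b≡A) A≢b
  ...   | inj₂ (there b∈z) = ∈-deduplicate⁺ _≟_ (∈-++⁺ʳ y b∈z)
  from : ∀ {b} → b ∈ deduplicate _≟_ (y ++ z) → b ∈ deduplicate _≟_ (y ++ A ∷ z) ∖ A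
  from {b} b∈ with ∈-deduplicate⁻ _≟_ (y ++ z) b∈
  ... | b∈yz = ∈-filter⁺ P? (∈-deduplicate⁺ _≟_ (∈-resp-↭ (↭-sym (shift A y z)) (there b∈yz)))
                 (λ { refl → A∉ b∈yz })

gauss-head : ∀ A u → IsGauss (A ∷ u) → A ∈ u
gauss-head A u g with A ∈? u
... | yes A∈u = A∈u
... | no A∉u with trans (sym (trans (occ-here A u) (cong suc (∉⇒occ≡0 u A∉u)))) (g A (here refl))
...   | ()

extendAt : ℕ → ℕ → (ℕ → ℕ) → ℕ → ℕ
extendAt A n f a with a ≟ A
... | yes _ = n
... | no _  = f a

extendAt-self : ∀ A n f → extendAt A n f A ≡ n
extendAt-self A n f with A ≟ A
... | yes _  = refl
... | no A≢A = contradiction refl A≢A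

extendAt-other : ∀ {A} n f {w} → A ∉ w → map (extendAt A n f) w ≡ map f w
extendAt-other {A} n f {w} A∉w = map-cong-local (All.tabulate agree)
  where
  agree : ∀ {a} → a ∈ w → extendAt A n f a ≡ f a
  agree {a} a∈w with a ≟ A
  ... | yes refl = contradiction a∈w A∉w
  ... | no _     = refl

Iso-insert : ∀ {A n} y z f → A ∉ y ++ z → All (_< n) (map f (y ++ z)) →
             (∀ a b → a ∈ y ++ z → b ∈ y ++ z → f a ≡ f b → a ≡ b) →
             Iso (A ∷ y ++ A ∷ z) (n ∷ map f y ++ n ∷ map f z)
Iso-insert {A} {n} y z f A∉ f<n f-inj = h , h-inj , image
  where
  h : ℕ → ℕ
  h = extendAt A n f
  image : map h (A ∷ y ++ A ∷ z) ≡ n ∷ map f y ++ n ∷ map f z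
  image = cong₂ _∷_ (extendAt-self A n f) (trans (map-++ h y (A ∷ z))
    (cong₂ _++_ (extendAt-other n f (A∉ ∘ ∈-++⁺ˡ))
      (cong₂ _∷_ (extendAt-self A n f) (extendAt-other n f (A∉ ∘ ∈-++⁺ʳ y)))))
  strip : ∀ {a} → a ≢ A → a ∈ A ∷ y ++ A ∷ z → a ∈ y ++ z
  strip a≢A (here a≡A) = contradiction a≡A a≢A
  strip a≢A (there a∈) with ∈-resp-↭ (shift A y z) a∈
  ... | here a≡A  = contradiction a≡A a≢A
  ... | there a∈′ = a∈′
  f≢n : ∀ {a} → a ∈ y ++ z → f a ≢ n
  f≢n a∈ fa≡n = <-irrefl fa≡n (All.lookup f<n (∈-map⁺ f a∈))
  h-inj : ∀ a b → a ∈ A ∷ y ++ A ∷ z → b ∈ A ∷ y ++ A ∷ z → h a ≡ h b → a ≡ b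
  h-inj a b a∈ b∈ eq with a ≟ A | b ≟ A
  ... | yes a≡A | yes b≡A = trans a≡A (sym b≡A)
  ... | yes _   | no b≢A  = contradiction (sym eq) (f≢n (strip b≢A b∈))
  ... | no a≢A  | yes _   = contradiction eq (f≢n (strip a≢A a∈))
  ... | no a≢A  | no b≢A  = f-inj a b (strip a≢A a∈) (strip b≢A b∈) eq

-- Removing both copies of the first letter lowers the rank by one. The bound on the letters of `c`
-- is carried through the induction because it keeps `n` free as the image of the removed letter.
canonical : ∀ n w → rank w ≡ n → IsGauss w → ∃ λ c → c ∈ chords n × All (_< n) c × Iso w c
canonical zero [] _ _ = [] , here refl , [] , (λ a → a) , (λ _ _ ()) , refl
canonical (suc n) (A ∷ u) r g with ∈-∃++ (gauss-head A u g)
... | y , z , refl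
  with canonical n (y ++ z) (suc-injective (trans (sym (rank-remove A y z (A∉ y z g))) r))
         (IsGauss-delete {A} (g′ y z g))
  where
  g′ : ∀ y z → IsGauss (A ∷ y ++ A ∷ z) → IsGauss (A ∷ A ∷ y ++ z)
  g′ y z = IsGauss-↭ (prep A (shift A y z))
  A∉ : ∀ y z → IsGauss (A ∷ y ++ A ∷ z) → A ∉ y ++ z
  A∉ y z g = IsGauss-fresh (g′ y z g)
... | _ , c∈ , c<n , f , f-inj , refl =
  n ∷ map f y ++ n ∷ map f z ,
  ∈-chords n (map f y) (map f z) (subst (_∈ chords n) (map-++ f y z) c∈) ,
  ≤-refl ∷ ++⁺ (proj₁ bounds) (≤-refl ∷ proj₂ bounds) ,
  Iso-insert y z f (IsGauss-fresh (IsGauss-↭ (prep A (shift A y z)) g)) c<n f-inj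
  where
  bounds : All (_< suc n) (map f y) × All (_< suc n) (map f z)
  bounds = ++⁻ (map f y) (subst (All (_< suc n)) (map-++ f y z) (All.map m<n⇒m<1+n c<n))

search : ℕ → ∀ w → IsGauss w → List (Reducible w)
search zero w g = reductions w g
search (suc n) w g = reductions w g ++
  concatMap (λ { (v , gv , h) → map (λ { (u , gu , r , k) → u , gu , r , h-trans h k }) (search n v gv) }) (slides w g)

-- Only the first entry is ever evaluated, so the order matters: the search through three slides is
-- reached only by words that neither reduce at once nor occur in the table.
classify : ∀ c → List (normalise c ∈ concat rowTable ⊎ Reducible c)
classify c = when (IsGauss? c) λ g →
  map inj₂ (reductions c g) ++ when (normalise c ∈ʷ? concat rowTable) (λ r → [ inj₁ r ]) ++
  map inj₂ (search 3 c g)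

-- The list has 1·3·5·7·9 = 945 words: the second copy of the k-th letter inserted can go to any of
-- 2k - 1 places.
chords-classified : All (T ∘ nonEmpty ∘ classify) (chords 5)
chords-classified = decided (All.all? (λ c → T? (nonEmpty (classify c))) (chords 5)) refl

chord-cases : ∀ {c} → c ∈ chords 5 → normalise c ∈ concat rowTable ⊎ Reducible c
chord-cases {c} c∈ = first (classify c) (All.lookup chords-classified c∈)

∈-concat-nth : ∀ rs {u} → u ∈ concat rs → ∃ λ i → u ∈ nth i rs
∈-concat-nth (r ∷ rs) u∈ with ∈-++⁻ r u∈
... | inj₁ u∈r = 0 , u∈r
... | inj₂ u∈rs with ∈-concat-nth rs u∈rs
...   | i , u∈i = suc i , u∈i

reduces : ∀ w → IsGauss w → rank w ≤ 5 → (∀ i u → u ∈ row i → ¬ Iso w u) → Reducible w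
reduces w g r≤5 notRow = by-rank (rank w ≤? 4)
  where
  by-cases : ∀ {c} → Iso w c → normalise c ∈ concat rowTable ⊎ Reducible c → Reducible w
  by-cases {c} iso (inj₁ inRow) = let i , c∈row = ∈-concat-nth rowTable inRow in
    contradiction (Iso-trans iso (Iso-normalise c)) (notRow i (normalise c) c∈row)
  by-cases iso (inj₂ (v , gv , r≤4 , h)) = v , gv , r≤4 , h-trans (h-iso g iso) h
  by-rank : Dec (rank w ≤ 4) → Reducible w
  by-rank (yes r≤4) = w , g , r≤4 , h-refl
  by-rank (no r≰4) = let c , c∈ , _ , iso = canonical 5 w (≤-antisym r≤5 (≰⇒> r≰4)) g in
    by-cases iso (chord-cases c∈)

-- Sums over subwords modulo 2

∖-here : ∀ a w → (a ∷ w) ∖ a ≡ w ∖ a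
∖-here a w = filter-reject (λ b → ¬? (a ≟ b)) (λ a≢a → a≢a refl)

∖-there : ∀ {a b} w → a ≢ b → (b ∷ w) ∖ a ≡ b ∷ w ∖ a
∖-there {a} w a≢b = filter-accept (λ b → ¬? (a ≟ b)) a≢b

∖-∉ : ∀ {a w} → a ∉ w → w ∖ a ≡ w
∖-∉ {a} a∉w = filter-all (λ b → ¬? (a ≟ b)) (All.tabulate λ { b∈w refl → a∉w b∈w })

∈-∖⁻ : ∀ {a b} w → b ∈ w ∖ a → b ∈ w × a ≢ b
∈-∖⁻ {a} w = ∈-filter⁻ (λ b → ¬? (a ≟ b)) {xs = w}

∖-++ : ∀ a u v → (u ++ v) ∖ a ≡ u ∖ a ++ v ∖ a
∖-++ a = filter-++ (λ b → ¬? (a ≟ b))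

∖-idem : ∀ a w → w ∖ a ∖ a ≡ w ∖ a
∖-idem a w = ∖-∉ {a} {w ∖ a} (λ a∈ → proj₂ (∈-∖⁻ w a∈) refl)

∖-comm : ∀ a b w → w ∖ a ∖ b ≡ w ∖ b ∖ a
∖-comm a b [] = refl
∖-comm a b (c ∷ w) with a ≟ c | b ≟ c
... | yes refl | yes refl = refl
... | yes refl | no b≢a
  rewrite ∖-here a w | ∖-there w b≢a | ∖-here a (w ∖ b) = ∖-comm a b w
... | no a≢b | yes refl
  rewrite ∖-there w a≢b | ∖-here b w | ∖-here b (w ∖ a) = ∖-comm a b w
... | no a≢c | no b≢c
  rewrite ∖-there w a≢c | ∖-there w b≢c | ∖-there (w ∖ a) b≢c | ∖-there (w ∖ b) a≢c = cong (c ∷_) (∖-comm a b w)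

-- Each letter of the list is either kept or deleted with all its copies. Over the distinct letters
-- of a Gauss word this is the sum over all its subwords.
sumOver : (Word → Bool) → List ℕ → Word → Bool
sumOver φ [] w = φ w
sumOver φ (l ∷ ls) w = sumOver φ ls w xor sumOver φ ls (w ∖ l)

sumOver-ext : ∀ {φ ψ} → (∀ w → φ w ≡ ψ w) → ∀ ls w → sumOver φ ls w ≡ sumOver ψ ls w
sumOver-ext eq [] w = eq w
sumOver-ext eq (l ∷ ls) w = cong₂ _xor_ (sumOver-ext eq ls w) (sumOver-ext eq ls (w ∖ l))

sumOver-xor : ∀ φ ψ ls w → sumOver (λ u → φ u xor ψ u) ls w ≡ sumOver φ ls w xor sumOver ψ ls w
sumOver-xor φ ψ [] w = refl
sumOver-xor φ ψ (l ∷ ls) w =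
  trans (cong₂ _xor_ (sumOver-xor φ ψ ls w) (sumOver-xor φ ψ ls (w ∖ l)))
    (xor-interchange (sumOver φ ls w) (sumOver ψ ls w) (sumOver φ ls (w ∖ l)) (sumOver ψ ls (w ∖ l)))

sumOver-cons : ∀ φ l ls ms → (∀ w → sumOver φ ls w ≡ sumOver φ ms w) →
               ∀ w → sumOver φ (l ∷ ls) w ≡ sumOver φ (l ∷ ms) w
sumOver-cons φ l ls ms eq w = cong₂ _xor_ (eq w) (eq (w ∖ l))

sumOver-swap : ∀ φ l m ls w → sumOver φ (l ∷ m ∷ ls) w ≡ sumOver φ (m ∷ l ∷ ls) w
sumOver-swap φ l m ls w rewrite ∖-comm l m w =
  xor-interchange (sumOver φ ls w) (sumOver φ ls (w ∖ m)) (sumOver φ ls (w ∖ l)) (sumOver φ ls (w ∖ m ∖ l))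

sumOver-↭ : ∀ φ {ls ms} → ls ↭ ms → ∀ w → sumOver φ ls w ≡ sumOver φ ms w
sumOver-↭ φ refl w = refl
sumOver-↭ φ (prep {ls} {ms} l p) w = sumOver-cons φ l ls ms (sumOver-↭ φ p) w
sumOver-↭ φ (swap {ls} {ms} l m p) w =
  trans (sumOver-swap φ l m ls w) (sumOver-cons φ m (l ∷ ls) (l ∷ ms) (sumOver-cons φ l ls ms (sumOver-↭ φ p)) w)
sumOver-↭ φ (↭-compose p q) w = trans (sumOver-↭ φ p w) (sumOver-↭ φ q w)

-- In characteristic 2 a repeated letter contributes an even number of extra copies.
sumOver-dup : ∀ φ l ls w → sumOver φ (l ∷ l ∷ ls) w ≡ sumOver φ (l ∷ ls) w
sumOver-dup φ l ls w
  rewrite ∖-idem l w | xor-same (sumOver φ ls (w ∖ l)) = xor-identityʳ _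

sumOver-absorb : ∀ φ l ms w → sumOver φ (l ∷ ms) w ≡ sumOver φ (l ∷ ms ∖ l) w
sumOver-absorb φ l [] w = refl
sumOver-absorb φ l (m ∷ ms) w with l ≟ m
... | yes refl rewrite ∖-here l ms = trans (sumOver-dup φ l ms w) (sumOver-absorb φ l ms w)
... | no l≢m rewrite ∖-there ms l≢m =
  trans (sumOver-swap φ l m ms w) (trans (sumOver-cons φ m (l ∷ ms) (l ∷ ms ∖ l) (sumOver-absorb φ l ms) w) (sumOver-swap φ m l (ms ∖ l) w))

total : (Word → Bool) → Word → Bool
total φ w = sumOver φ (deduplicate _≟_ w) w

sumOver-deduplicate : ∀ φ ls w → sumOver φ (deduplicate _≟_ ls) w ≡ sumOver φ ls w
sumOver-deduplicate φ [] w = refl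
sumOver-deduplicate φ (l ∷ ls) w =
  trans (sym (sumOver-absorb φ l (deduplicate _≟_ ls) w)) (sumOver-cons φ l (deduplicate _≟_ ls) ls (sumOver-deduplicate φ ls) w)

plug-∖ : ∀ bs l q → plug (frame bs) q ∖ l ≡ plug (frame (map (_∖ l) bs)) q
plug-∖ bs l [] = refl
plug-∖ bs l (i ∷ q) = begin
  plug (frame bs) (i ∷ q) ∖ l                    ≡⟨ cong (_∖ l) (plug-∷ (frame bs) i q) ⟩
  (frame bs i ++ plug (frame bs) q) ∖ l          ≡⟨ ∖-++ l (frame bs i) _ ⟩
  frame bs i ∖ l ++ plug (frame bs) q ∖ l        ≡⟨ cong₂ _++_ (frame-∖ bs i) (plug-∖ bs l q) ⟩
  frame bs′ i ++ plug (frame bs′) q              ≡⟨ plug-∷ (frame bs′) i q ⟨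
  plug (frame bs′) (i ∷ q)                       ∎
  where
  open ≡-Reasoning
  bs′ : List Word
  bs′ = map (_∖ l) bs
  frame-∖ : ∀ bs i → frame bs i ∖ l ≡ frame (map (_∖ l) bs) i
  frame-∖ [] i = refl
  frame-∖ (b ∷ bs) zero = refl
  frame-∖ (b ∷ bs) (suc i) = frame-∖ bs i

plug-∖-letter : ∀ ρ {k A} → ρ k ≡ [ A ] → (∀ i → i ≢ k → A ∉ ρ i) →
                ∀ q → plug ρ q ∖ A ≡ plug ρ (q ∖ k)
plug-∖-letter ρ eqA A∉ [] = refl
plug-∖-letter ρ {k} {A} eqA A∉ (i ∷ q) with k ≟ i
... | yes refl rewrite plug-∷ ρ k q | eqA | ∖-here A (plug ρ q) | ∖-here k q = plug-∖-letter ρ eqA A∉ q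
... | no k≢i rewrite plug-∷ ρ i q | ∖-there q k≢i | plug-∷ ρ i (q ∖ k) | ∖-++ A (ρ i) (plug ρ q)
                   | ∖-∉ (A∉ i (k≢i ∘ sym)) = cong (ρ i ++_) (plug-∖-letter ρ eqA A∉ q)

record LetterAt (ρ : ℕ → Word) (k : ℕ) : Set where
  field
    letter   : ℕ
    occupies : ρ k ≡ [ letter ]
    isolated : ∀ i → i ≢ k → letter ∉ ρ i
open LetterAt

letters : ∀ {ρ ks} → All (LetterAt ρ) ks → List ℕ
letters [] = []
letters (a ∷ as) = letter a ∷ letters as

sumOver-letters : ∀ φ ls ρ {ks} (as : All (LetterAt ρ) ks) q →
  sumOver φ (letters as ++ ls) (plug ρ q) ≡ sumOver (λ q → sumOver φ ls (plug ρ q)) ks q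
sumOver-letters φ ls ρ [] q = refl
sumOver-letters φ ls ρ {k ∷ _} (a ∷ as) q
  rewrite plug-∖-letter ρ (occupies a) (isolated a) q =
  cong₂ _xor_ (sumOver-letters φ ls ρ as q) (sumOver-letters φ ls ρ as (q ∖ k))

doubled : List ℕ → List ℕ
doubled [] = []
doubled (k ∷ ks) = k ∷ k ∷ doubled ks

sumOver-doubled : ∀ φ ρ {ks} (as : All (LetterAt ρ) ks) r w →
  sumOver φ (plug ρ (doubled ks ++ r)) w ≡ sumOver φ (letters as ++ plug ρ r) w
sumOver-doubled φ ρ [] r w = refl
sumOver-doubled φ ρ {k ∷ ks} (a ∷ as) r w rewrite plug-double ρ (doubled ks ++ r) (occupies a) =
  trans (sumOver-dup φ (letter a) (plug ρ (doubled ks ++ r)) w) 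
    (sumOver-cons φ (letter a) (plug ρ (doubled ks ++ r)) (letters as ++ plug ρ r) (sumOver-doubled φ ρ as r) w)

-- The outer sum deletes indices from the pattern, the inner one deletes letters inside the blocks.
-- The outer sum has the same few patterns for all words, and these are what the two sides of a move
-- are compared on.
total-plug : ∀ φ ρ {ks} → All (LetterAt ρ) ks → ∀ r p → sort p ≡ sort (doubled ks ++ r) →
  total φ (plug ρ p) ≡ sumOver (λ q → sumOver φ (plug ρ r) (plug ρ q)) ks p
total-plug φ ρ {ks} as r p eq = begin
  total φ w                                       ≡⟨ sumOver-deduplicate φ w w ⟩
  sumOver φ w w                                   ≡⟨ sumOver-↭ φ (rearrange ρ p (doubled ks ++ r) eq) w ⟩
  sumOver φ (plug ρ (doubled ks ++ r)) w          ≡⟨ sumOver-doubled φ ρ as r w ⟩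
  sumOver φ (letters as ++ plug ρ r) w            ≡⟨ sumOver-letters φ (plug ρ r) ρ as p ⟩
  sumOver (λ q → sumOver φ (plug ρ r) (plug ρ q)) ks p ∎
  where
  open ≡-Reasoning
  w : Word
  w = plug ρ p

-- A relation between the values of φ on words that differ in a few letters passes
-- to the sums over the remaining letters, because these are deleted blockwise.
sum-relation : ∀ φ (Good : List Word → Set) {ks ms p q} →
  (∀ bs → Good bs → sumOver (φ ∘ plug (frame bs)) ks p ≡ sumOver (φ ∘ plug (frame bs)) ms q) →
  ∀ ls → (∀ l bs → l ∈ ls → Good bs → Good (map (_∖ l) bs)) → ∀ bs → Good bs →
  sumOver (λ q → sumOver φ ls (plug (frame bs) q)) ks p ≡ sumOver (λ q → sumOver φ ls (plug (frame bs) q)) ms q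
sum-relation φ Good rel [] closed bs good = rel bs good
sum-relation φ Good {ks} {ms} {p} {q} rel (l ∷ ls) closed bs good = begin
  sumOver (λ q → Σφ bs q xor sumOver φ ls (plug (frame bs) q ∖ l)) ks p  ≡⟨ split ks p ⟩
  sumOver (Σφ bs) ks p xor sumOver (Σφ bs′) ks p                         ≡⟨ cong₂ _xor_ (ih bs good) (ih bs′ (closed l bs (here refl) good)) ⟩
  sumOver (Σφ bs) ms q xor sumOver (Σφ bs′) ms q                         ≡⟨ split ms q ⟨
  sumOver (λ q → Σφ bs q xor sumOver φ ls (plug (frame bs) q ∖ l)) ms q  ∎
  where
  open ≡-Reasoning
  Σφ : List Word → List ℕ → Bool
  Σφ bs q = sumOver φ ls (plug (frame bs) q)
  bs′ : List Word
  bs′ = map (_∖ l) bs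
  ih : ∀ bs → Good bs → sumOver (Σφ bs) ks p ≡ sumOver (Σφ bs) ms q
  ih = sum-relation φ Good {ks} {ms} {p} {q} rel ls (λ m bs m∈ → closed m bs (there m∈))
  split : ∀ ks p → sumOver (λ q → Σφ bs q xor sumOver φ ls (plug (frame bs) q ∖ l)) ks p
                 ≡ sumOver (Σφ bs) ks p xor sumOver (Σφ bs′) ks p
  split ks p = trans
    (sumOver-ext (λ q → cong (λ v → Σφ bs q xor sumOver φ ls v) (plug-∖ bs l q)) ks p)
    (sumOver-xor (Σφ bs) (Σφ bs′) ks p)

-- Functions on coloured words

half-tag : ∀ {c} i → c < 2 → (c + i * 2) / 2 ≡ i
half-tag {c} i c<2 = trans (+-distrib-/-∣ʳ c (n∣m*n i)) (cong₂ _+_ (m<n⇒m/n≡0 c<2) (m*n/n≡m i 2))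

InjectiveOn : (ℕ → ℕ) → Word → Set
InjectiveOn f w = ∀ a b → a ∈ w → b ∈ w → f a ≡ f b → a ≡ b

firstIndex-map : ∀ f a w → (∀ b → b ∈ w → f a ≡ f b → a ≡ b) → firstIndex (f a) (map f w) ≡ firstIndex a w
firstIndex-map f a [] inj = refl
firstIndex-map f a (c ∷ w) inj with f a ≟ f c | a ≟ c
... | yes _     | yes _   = refl
... | yes fa≡fc | no a≢c  = contradiction (inj c (here refl) fa≡fc) a≢c
... | no fa≢fc  | yes refl = contradiction refl fa≢fc
... | no _      | no _    = cong suc (firstIndex-map f a w (λ b b∈ → inj b (there b∈)))

-- The letter with index n and colour c ∈ {0, 1} is the number c + 2n, and a word is
-- coded by replacing the index of each letter by the position of its first occurrence.
code : Word → Word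
code w = map (λ a → a % 2 + firstIndex a w * 2) w

code-map : ∀ f w → InjectiveOn f w → (∀ a → a ∈ w → f a % 2 ≡ a % 2) → code (map f w) ≡ code w
code-map f w inj par = trans (sym (map-∘ w)) (map-cong-local (All.tabulate λ {a} a∈ →
  cong₂ (λ c n → c + n * 2) (par a a∈) (firstIndex-map f a w (λ b → inj a b a∈))))

indicator : List Word → Word → Bool
indicator t u = does (code u ∈ʷ? t)

indicator-map : ∀ t f w → InjectiveOn f w → (∀ a → a ∈ w → f a % 2 ≡ a % 2) → indicator t (map f w) ≡ indicator t w
indicator-map t f w inj par = cong (λ c → does (c ∈ʷ? t)) (code-map f w inj par)

kinkAt : Word → Bool
kinkAt (a ∷ b ∷ _) = (a ≡ᵇ b) ∧ (a % 2 ≡ᵇ 0)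
kinkAt _ = false

closes : ℕ → ℕ → Word → Bool
closes a b (c ∷ d ∷ _) = (c ≡ᵇ b) ∧ (d ≡ᵇ a)
closes _ _ _ = false

bigonAt : Word → Bool
bigonAt (a ∷ b ∷ w) = (a % 2 ≡ᵇ b % 2) ∧ any (closes a b ∘ proj₂) (splits w)
bigonAt _ = false

hasReduction : Word → Bool
hasReduction w = any (λ s → kinkAt (proj₂ s) ∨ bigonAt (proj₂ s)) (splits w)

kink-hasReduction : ∀ x a y → a % 2 ≡ 0 → T (hasReduction (x ++ a ∷ a ∷ y))
kink-hasReduction x a y even = any⁺ _ (lose (∈-splits x (a ∷ a ∷ y))
  (Equivalence.from T-∨ (inj₁ (Equivalence.from T-∧ (≡⇒≡ᵇ a a refl , ≡⇒≡ᵇ (a % 2) 0 even)))))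

bigon-hasReduction : ∀ x a b y z → a % 2 ≡ b % 2 → T (hasReduction (x ++ a ∷ b ∷ y ++ b ∷ a ∷ z))
bigon-hasReduction x a b y z same = any⁺ _ (lose (∈-splits x (a ∷ b ∷ y ++ b ∷ a ∷ z))
  (Equivalence.from T-∨ (inj₂ (Equivalence.from T-∧ (≡⇒≡ᵇ (a % 2) (b % 2) same ,
    any⁺ _ (lose (∈-splits y (b ∷ a ∷ z)) (Equivalence.from T-∧ (≡⇒≡ᵇ b b refl , ≡⇒≡ᵇ a a refl))))))))

tuples : ℕ → List ℕ → List Word
tuples zero as = [ [] ]
tuples (suc n) as = concatMap (λ a → map (a ∷_) (tuples n as)) as

∈-tuples : ∀ {as} w → All (_∈ as) w → w ∈ tuples (length w) as
∈-tuples [] [] = here refl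
∈-tuples {as} (a ∷ w) (a∈ ∷ w⊆) = ∈-concatMap⁺ (λ a → map (a ∷_) (tuples (length w) as)) {xs = as}
  (lose a∈ (∈-map⁺ (a ∷_) (∈-tuples w w⊆)))

coded-Gauss? : ∀ w → Dec (code w ≡ w × IsGauss w)
coded-Gauss? w = (code w ≟ʷ w) ×-dec IsGauss? w

-- A coded letter of a word of length at most `n` has index below `n` and so is itself below 2n. The
-- fixed points of `code` represent each coloured Gauss word once.
shortCodes : ℕ → List Word
shortCodes n = filter coded-Gauss? (concatMap (λ k → tuples k (upTo (n * 2))) (upTo (suc n)))

leftH3 rightH3 : List ℕ
leftH3  = 3 ∷ 0 ∷ 1 ∷ 4 ∷ 0 ∷ 2 ∷ 5 ∷ 1 ∷ 2 ∷ 6 ∷ []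
rightH3 = 3 ∷ 1 ∷ 0 ∷ 4 ∷ 2 ∷ 0 ∷ 5 ∷ 2 ∷ 1 ∷ 6 ∷ []

blocks : ℕ → ℕ → ℕ → Word → Word → Word → Word → List Word
blocks A B C x y z v = [ A ] ∷ [ B ] ∷ [ C ] ∷ x ∷ y ∷ z ∷ v ∷ []

-- In a coded word of length n all indices are below n, so that n, n + 1 and n + 2 are free.
coloured : ℕ → ℕ → ℕ → Word → Word → Word → Word → List Word
coloured n i j = blocks (i + n * 2) (j + suc n * 2) ((i + j) % 2 + suc (suc n) * 2)

module _ (t : List Word) where

  side : List ℕ → List Word → Bool
  side p bs = sumOver (indicator t ∘ plug (frame bs)) (0 ∷ 1 ∷ 2 ∷ []) p

  -- The three splittings run through all positions of the three pairs in `u`. The colours of A and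
  -- B are free; that of C is then forced by the parity condition in (H3).
  Balanced : Word → Set
  Balanced u =
    All (λ s → All (λ s′ → All (λ s″ → All (λ i → All (λ j →
      side leftH3  (coloured (length u) i j (proj₁ s) (proj₁ s′) (proj₁ s″) (proj₂ s″)) ≡
      side rightH3 (coloured (length u) i j (proj₁ s) (proj₁ s′) (proj₁ s″) (proj₂ s″)))
      (upTo 2)) (upTo 2)) (splits (proj₂ s′))) (splits (proj₂ s))) (splits u)

  balanced? : ∀ u → Dec (Balanced u)
  balanced? u =
    All.all? (λ s → All.all? (λ s′ → All.all? (λ s″ → All.all? (λ i → All.all? (λ j →
      side leftH3  (coloured (length u) i j (proj₁ s) (proj₁ s′) (proj₁ s″) (proj₂ s″)) Bool.≟
      side rightH3 (coloured (length u) i j (proj₁ s) (proj₁ s′) (proj₁ s″) (proj₂ s″)))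
      (upTo 2)) (upTo 2)) (splits (proj₂ s′))) (splits (proj₂ s))) (splits u)

  -- If xyzt is longer than n, then every word in (H3) with at least two of the letters
  -- A, B, C is longer than 4 + n, and the other words occur on both sides.
  record Admissible (n : ℕ) : Set where
    constructor admissible
    field
      irreducible : All (λ s → ¬ T (hasReduction s)) t
      short       : All (λ s → length s ≤ 4 + n) t
      relation    : All Balanced (shortCodes n)

  admissible? : ∀ n → Dec (Admissible n)
  admissible? n = map′ (λ { (p , q , r) → admissible p q r }) (λ { (admissible p q r) → p , q , r })
    (All.all? (λ s → ¬? (T? (hasReduction s))) t ×-dec All.all? (λ s → length s ≤? 4 + n) t
      ×-dec All.all? balanced? (shortCodes n))

-- Each of the eight functions φ is given by the words on which its value is 1.
letterTables : List (ℕ × List Word)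
letterTables =
    (0 ,
      (0 ∷ 3 ∷ 3 ∷ 0 ∷ []) ∷
      []) ∷
    (2 ,
      (1 ∷ 1 ∷ 2 ∷ 5 ∷ 5 ∷ 2 ∷ []) ∷
      (1 ∷ 2 ∷ 1 ∷ 4 ∷ 2 ∷ 4 ∷ []) ∷
      (1 ∷ 3 ∷ 1 ∷ 4 ∷ 3 ∷ 4 ∷ []) ∷
      (0 ∷ 3 ∷ 3 ∷ 0 ∷ 5 ∷ 5 ∷ []) ∷
      (1 ∷ 3 ∷ 3 ∷ 5 ∷ 5 ∷ 1 ∷ []) ∷
      (1 ∷ 3 ∷ 4 ∷ 3 ∷ 4 ∷ 1 ∷ []) ∷
      []) ∷
    (2 ,
      (1 ∷ 1 ∷ 3 ∷ 3 ∷ 5 ∷ 5 ∷ []) ∷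
      (1 ∷ 1 ∷ 3 ∷ 4 ∷ 3 ∷ 4 ∷ []) ∷
      (0 ∷ 3 ∷ 0 ∷ 3 ∷ 5 ∷ 5 ∷ []) ∷
      (0 ∷ 2 ∷ 0 ∷ 5 ∷ 2 ∷ 5 ∷ []) ∷
      (0 ∷ 3 ∷ 4 ∷ 0 ∷ 4 ∷ 3 ∷ []) ∷
      (0 ∷ 3 ∷ 3 ∷ 4 ∷ 0 ∷ 4 ∷ []) ∷
      []) ∷
    (2 ,
      (1 ∷ 2 ∷ 1 ∷ 4 ∷ 2 ∷ 4 ∷ []) ∷
      (1 ∷ 3 ∷ 1 ∷ 5 ∷ 5 ∷ 3 ∷ []) ∷
      (1 ∷ 3 ∷ 4 ∷ 1 ∷ 4 ∷ 3 ∷ []) ∷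
      (0 ∷ 3 ∷ 3 ∷ 4 ∷ 0 ∷ 4 ∷ []) ∷
      (1 ∷ 3 ∷ 3 ∷ 4 ∷ 1 ∷ 4 ∷ []) ∷
      (0 ∷ 3 ∷ 5 ∷ 5 ∷ 0 ∷ 3 ∷ []) ∷
      (1 ∷ 2 ∷ 5 ∷ 5 ∷ 2 ∷ 1 ∷ []) ∷
      []) ∷
    (2 ,
      (1 ∷ 1 ∷ 2 ∷ 5 ∷ 5 ∷ 2 ∷ []) ∷
      (0 ∷ 3 ∷ 0 ∷ 4 ∷ 3 ∷ 4 ∷ []) ∷
      (1 ∷ 3 ∷ 1 ∷ 5 ∷ 5 ∷ 3 ∷ []) ∷
      (0 ∷ 3 ∷ 3 ∷ 0 ∷ 5 ∷ 5 ∷ []) ∷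
      (1 ∷ 2 ∷ 5 ∷ 1 ∷ 2 ∷ 5 ∷ []) ∷
      (1 ∷ 3 ∷ 3 ∷ 5 ∷ 1 ∷ 5 ∷ []) ∷
      (0 ∷ 3 ∷ 3 ∷ 5 ∷ 5 ∷ 0 ∷ []) ∷
      (0 ∷ 3 ∷ 4 ∷ 3 ∷ 4 ∷ 0 ∷ []) ∷
      []) ∷
    (4 ,
      (1 ∷ 2 ∷ 1 ∷ 4 ∷ 2 ∷ 7 ∷ 4 ∷ 7 ∷ []) ∷
      (1 ∷ 2 ∷ 1 ∷ 5 ∷ 2 ∷ 7 ∷ 5 ∷ 7 ∷ []) ∷
      (1 ∷ 2 ∷ 1 ∷ 5 ∷ 6 ∷ 2 ∷ 5 ∷ 6 ∷ []) ∷
      (1 ∷ 3 ∷ 1 ∷ 5 ∷ 6 ∷ 3 ∷ 5 ∷ 6 ∷ []) ∷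
      (1 ∷ 2 ∷ 1 ∷ 4 ∷ 7 ∷ 2 ∷ 7 ∷ 4 ∷ []) ∷
      (1 ∷ 3 ∷ 1 ∷ 4 ∷ 7 ∷ 3 ∷ 7 ∷ 4 ∷ []) ∷
      (1 ∷ 2 ∷ 1 ∷ 5 ∷ 6 ∷ 5 ∷ 2 ∷ 6 ∷ []) ∷
      (1 ∷ 3 ∷ 1 ∷ 5 ∷ 6 ∷ 5 ∷ 3 ∷ 6 ∷ []) ∷
      (1 ∷ 3 ∷ 1 ∷ 4 ∷ 7 ∷ 4 ∷ 7 ∷ 3 ∷ []) ∷
      (1 ∷ 3 ∷ 1 ∷ 5 ∷ 6 ∷ 5 ∷ 6 ∷ 3 ∷ []) ∷
      (1 ∷ 2 ∷ 4 ∷ 1 ∷ 2 ∷ 7 ∷ 4 ∷ 7 ∷ []) ∷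
      (1 ∷ 2 ∷ 5 ∷ 1 ∷ 2 ∷ 7 ∷ 5 ∷ 7 ∷ []) ∷
      (1 ∷ 3 ∷ 4 ∷ 1 ∷ 7 ∷ 4 ∷ 7 ∷ 3 ∷ []) ∷
      (1 ∷ 3 ∷ 5 ∷ 1 ∷ 7 ∷ 5 ∷ 7 ∷ 3 ∷ []) ∷
      (0 ∷ 3 ∷ 4 ∷ 3 ∷ 0 ∷ 7 ∷ 4 ∷ 7 ∷ []) ∷
      (0 ∷ 3 ∷ 5 ∷ 3 ∷ 0 ∷ 7 ∷ 5 ∷ 7 ∷ []) ∷
      (0 ∷ 3 ∷ 4 ∷ 3 ∷ 6 ∷ 0 ∷ 4 ∷ 6 ∷ []) ∷
      (0 ∷ 3 ∷ 5 ∷ 3 ∷ 6 ∷ 0 ∷ 5 ∷ 6 ∷ []) ∷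
      (0 ∷ 3 ∷ 5 ∷ 6 ∷ 5 ∷ 0 ∷ 6 ∷ 3 ∷ []) ∷
      (0 ∷ 3 ∷ 5 ∷ 7 ∷ 5 ∷ 0 ∷ 7 ∷ 3 ∷ []) ∷
      (0 ∷ 3 ∷ 4 ∷ 3 ∷ 6 ∷ 4 ∷ 0 ∷ 6 ∷ []) ∷
      (0 ∷ 3 ∷ 5 ∷ 3 ∷ 6 ∷ 5 ∷ 0 ∷ 6 ∷ []) ∷
      (0 ∷ 3 ∷ 4 ∷ 7 ∷ 4 ∷ 7 ∷ 0 ∷ 3 ∷ []) ∷
      (0 ∷ 3 ∷ 5 ∷ 6 ∷ 5 ∷ 6 ∷ 0 ∷ 3 ∷ []) ∷
      (1 ∷ 2 ∷ 4 ∷ 7 ∷ 4 ∷ 7 ∷ 2 ∷ 1 ∷ []) ∷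
      (1 ∷ 2 ∷ 5 ∷ 6 ∷ 5 ∷ 6 ∷ 2 ∷ 1 ∷ []) ∷
      []) ∷
    (4 ,
      (0 ∷ 3 ∷ 0 ∷ 4 ∷ 3 ∷ 4 ∷ []) ∷
      (0 ∷ 2 ∷ 5 ∷ 2 ∷ 5 ∷ 0 ∷ []) ∷
      (0 ∷ 2 ∷ 5 ∷ 0 ∷ 6 ∷ 2 ∷ 5 ∷ 6 ∷ []) ∷
      (0 ∷ 3 ∷ 4 ∷ 0 ∷ 6 ∷ 3 ∷ 4 ∷ 6 ∷ []) ∷
      (0 ∷ 2 ∷ 5 ∷ 0 ∷ 6 ∷ 5 ∷ 2 ∷ 6 ∷ []) ∷
      (0 ∷ 3 ∷ 4 ∷ 0 ∷ 6 ∷ 4 ∷ 3 ∷ 6 ∷ []) ∷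
      (0 ∷ 2 ∷ 5 ∷ 2 ∷ 5 ∷ 7 ∷ 0 ∷ 7 ∷ []) ∷
      (0 ∷ 3 ∷ 4 ∷ 3 ∷ 4 ∷ 7 ∷ 0 ∷ 7 ∷ []) ∷
      (0 ∷ 2 ∷ 5 ∷ 2 ∷ 7 ∷ 5 ∷ 0 ∷ 7 ∷ []) ∷
      (0 ∷ 3 ∷ 4 ∷ 3 ∷ 7 ∷ 4 ∷ 0 ∷ 7 ∷ []) ∷
      (0 ∷ 2 ∷ 5 ∷ 7 ∷ 2 ∷ 5 ∷ 0 ∷ 7 ∷ []) ∷
      (0 ∷ 3 ∷ 4 ∷ 7 ∷ 3 ∷ 4 ∷ 0 ∷ 7 ∷ []) ∷
      (0 ∷ 2 ∷ 5 ∷ 7 ∷ 2 ∷ 7 ∷ 0 ∷ 5 ∷ []) ∷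
      (0 ∷ 3 ∷ 5 ∷ 6 ∷ 3 ∷ 6 ∷ 0 ∷ 5 ∷ []) ∷
      (0 ∷ 3 ∷ 4 ∷ 7 ∷ 4 ∷ 7 ∷ 0 ∷ 3 ∷ []) ∷
      (0 ∷ 3 ∷ 5 ∷ 6 ∷ 5 ∷ 6 ∷ 0 ∷ 3 ∷ []) ∷
      (0 ∷ 2 ∷ 5 ∷ 2 ∷ 7 ∷ 5 ∷ 7 ∷ 0 ∷ []) ∷
      (0 ∷ 3 ∷ 4 ∷ 3 ∷ 6 ∷ 4 ∷ 6 ∷ 0 ∷ []) ∷
      (0 ∷ 3 ∷ 4 ∷ 3 ∷ 7 ∷ 4 ∷ 7 ∷ 0 ∷ []) ∷
      (0 ∷ 3 ∷ 5 ∷ 3 ∷ 6 ∷ 5 ∷ 6 ∷ 0 ∷ []) ∷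
      (0 ∷ 2 ∷ 5 ∷ 6 ∷ 2 ∷ 5 ∷ 6 ∷ 0 ∷ []) ∷
      (0 ∷ 3 ∷ 4 ∷ 7 ∷ 3 ∷ 4 ∷ 7 ∷ 0 ∷ []) ∷
      (0 ∷ 2 ∷ 5 ∷ 6 ∷ 2 ∷ 6 ∷ 5 ∷ 0 ∷ []) ∷
      (0 ∷ 3 ∷ 4 ∷ 7 ∷ 3 ∷ 7 ∷ 4 ∷ 0 ∷ []) ∷
      (0 ∷ 2 ∷ 5 ∷ 6 ∷ 5 ∷ 2 ∷ 6 ∷ 0 ∷ []) ∷
      (0 ∷ 2 ∷ 5 ∷ 7 ∷ 5 ∷ 2 ∷ 7 ∷ 0 ∷ []) ∷
      (0 ∷ 3 ∷ 4 ∷ 7 ∷ 4 ∷ 7 ∷ 3 ∷ 0 ∷ []) ∷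
      (0 ∷ 3 ∷ 5 ∷ 6 ∷ 5 ∷ 6 ∷ 3 ∷ 0 ∷ []) ∷
      []) ∷
    (4 ,
      (0 ∷ 3 ∷ 0 ∷ 4 ∷ 3 ∷ 7 ∷ 7 ∷ 4 ∷ []) ∷
      (0 ∷ 3 ∷ 0 ∷ 4 ∷ 7 ∷ 3 ∷ 7 ∷ 4 ∷ []) ∷
      (0 ∷ 3 ∷ 0 ∷ 4 ∷ 7 ∷ 7 ∷ 3 ∷ 4 ∷ []) ∷
      (1 ∷ 2 ∷ 1 ∷ 4 ∷ 7 ∷ 7 ∷ 4 ∷ 2 ∷ []) ∷
      (1 ∷ 2 ∷ 4 ∷ 1 ∷ 4 ∷ 7 ∷ 7 ∷ 2 ∷ []) ∷
      (1 ∷ 2 ∷ 5 ∷ 6 ∷ 1 ∷ 6 ∷ 5 ∷ 2 ∷ []) ∷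
      (1 ∷ 2 ∷ 5 ∷ 5 ∷ 6 ∷ 1 ∷ 6 ∷ 2 ∷ []) ∷
      (1 ∷ 2 ∷ 4 ∷ 7 ∷ 7 ∷ 4 ∷ 1 ∷ 2 ∷ []) ∷
      (0 ∷ 3 ∷ 3 ∷ 5 ∷ 5 ∷ 7 ∷ 7 ∷ 0 ∷ []) ∷
      (0 ∷ 3 ∷ 3 ∷ 4 ∷ 7 ∷ 4 ∷ 7 ∷ 0 ∷ []) ∷
      (0 ∷ 2 ∷ 5 ∷ 2 ∷ 5 ∷ 7 ∷ 7 ∷ 0 ∷ []) ∷
      (0 ∷ 2 ∷ 5 ∷ 2 ∷ 7 ∷ 5 ∷ 7 ∷ 0 ∷ []) ∷
      (0 ∷ 2 ∷ 5 ∷ 2 ∷ 7 ∷ 7 ∷ 5 ∷ 0 ∷ []) ∷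
      (0 ∷ 3 ∷ 4 ∷ 7 ∷ 4 ∷ 3 ∷ 7 ∷ 0 ∷ []) ∷
      (0 ∷ 3 ∷ 5 ∷ 5 ∷ 7 ∷ 7 ∷ 3 ∷ 0 ∷ []) ∷
      (0 ∷ 3 ∷ 4 ∷ 7 ∷ 4 ∷ 7 ∷ 3 ∷ 0 ∷ []) ∷
      (0 ∷ 3 ∷ 4 ∷ 7 ∷ 7 ∷ 4 ∷ 3 ∷ 0 ∷ []) ∷
      []) ∷
    []

-- In the literals, 2i + c is the letter of colour c that is the i-th to appear, counted from 0;
-- `code` replaces this count by the position of the first occurrence.
tables : List (ℕ × List Word)
tables = map (λ { (n , ws) → n , map code ws }) letterTables

tables-admissible : All (λ t → Admissible (proj₂ t) (proj₁ t)) tables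
tables-admissible = decided (All.all? (λ t → admissible? (proj₂ t) (proj₁ t)) tables) refl

-- Invariance of the sums of admissible functions under coloured moves

code-length : ∀ w → length (code w) ≡ length w
code-length w = length-map _ w

tag-colour : ∀ c n → c < 2 → (c + n * 2) % 2 ≡ c
tag-colour 0 n _ = [m+kn]%n≡m%n 0 n 2
tag-colour 1 n _ = [m+kn]%n≡m%n 1 n 2
tag-colour (suc (suc _)) n (s≤s (s≤s ()))

code-colour : ∀ a n → (a % 2 + n * 2) % 2 ≡ a % 2
code-colour a n = tag-colour (a % 2) n (m%n<n a 2)

tag-injective : ∀ {c d m n} → c < 2 → d < 2 → c + m * 2 ≡ d + n * 2 → m ≡ n
tag-injective {m = m} {n} c<2 d<2 eq = trans (sym (half-tag m c<2)) (trans (cong (_/ 2) eq) (half-tag n d<2))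

firstIndex-< : ∀ {a} w → a ∈ w → firstIndex a w < length w
firstIndex-< {a} (b ∷ w) a∈ with a ≟ b
firstIndex-< (b ∷ w) a∈ | yes _ = s≤s z≤n
firstIndex-< (b ∷ w) (here a≡b) | no a≢b = contradiction a≡b a≢b
firstIndex-< (b ∷ w) (there a∈) | no _ = s≤s (firstIndex-< w a∈)

firstIndex-++ˡ : ∀ {a} u v → a ∈ u → firstIndex a (u ++ v) ≡ firstIndex a u
firstIndex-++ˡ {a} (b ∷ u) v a∈ with a ≟ b
firstIndex-++ˡ (b ∷ u) v a∈ | yes _ = refl
firstIndex-++ˡ (b ∷ u) v (here a≡b) | no a≢b = contradiction a≡b a≢b
firstIndex-++ˡ (b ∷ u) v (there a∈) | no _ = cong suc (firstIndex-++ˡ u v a∈)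

firstIndex-++ʳ : ∀ {a} u v → a ∉ u → firstIndex a (u ++ v) ≡ length u + firstIndex a v
firstIndex-++ʳ [] v a∉ = refl
firstIndex-++ʳ {a} (b ∷ u) v a∉ with a ≟ b
... | yes a≡b = contradiction (here a≡b) a∉
... | no _    = cong suc (firstIndex-++ʳ u v (a∉ ∘ there))

occ-map : ∀ f a w → (∀ b → b ∈ w → f a ≡ f b → a ≡ b) → occ (f a) (map f w) ≡ occ a w
occ-map f a [] inj = refl
occ-map f a (c ∷ w) inj with f a ≟ f c | a ≟ c
... | yes _     | yes _    = cong suc (occ-map f a w (λ b b∈ → inj b (there b∈)))
... | yes fa≡fc | no a≢c   = contradiction (inj c (here refl) fa≡fc) a≢c
... | no fa≢fc  | yes refl = contradiction refl fa≢fc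
... | no _      | no _     = occ-map f a w (λ b b∈ → inj b (there b∈))

IsGauss-map : ∀ f w → InjectiveOn f w → IsGauss w → IsGauss (map f w)
IsGauss-map f w inj g b b∈ with ∈-map⁻ f b∈
... | a , a∈ , refl = trans (occ-map f a w (λ b → inj a b a∈)) (g a a∈)

occ-∖ : ∀ {a b} w → a ≢ b → occ a (w ∖ b) ≡ occ a w
occ-∖ [] a≢b = refl
occ-∖ {a} {b} (c ∷ w) a≢b with b ≟ c
... | yes refl rewrite ∖-here b w = trans (occ-∖ w a≢b) (sym (occ-there w a≢b))
... | no b≢c rewrite ∖-there w b≢c | occ-∷ a c w | occ-∷ a c (w ∖ b) = cong (occ a [ c ] +_) (occ-∖ w a≢b)

IsGauss-∖ : ∀ b w → IsGauss w → IsGauss (w ∖ b)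
IsGauss-∖ b w g a a∈ with ∈-∖⁻ w a∈
... | a∈w , b≢a = trans (occ-∖ w (b≢a ∘ sym)) (g a a∈w)

-- The renaming behind `code`, with the reference word as a parameter so that it can also be applied
-- to words assembled from letters of `v`.
codeIn : Word → ℕ → ℕ
codeIn v a = a % 2 + firstIndex a v * 2

codeIn-injective : ∀ v → InjectiveOn (codeIn v) v
codeIn-injective v a b a∈ b∈ eq = firstIndex-injective v a∈ b∈ (tag-injective (m%n<n a 2) (m%n<n b 2) eq)

code∈shortCodes : ∀ n u → IsGauss u → length u ≤ n → code u ∈ shortCodes n
code∈shortCodes n u g l = ∈-filter⁺ coded-Gauss?
  (∈-concatMap⁺ (λ k → tuples k (upTo (n * 2))) {xs = upTo (suc n)}
    (lose (∈-upTo⁺ (s≤s l)) (subst (λ k → code u ∈ tuples k (upTo (n * 2))) (code-length u)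
      (∈-tuples (code u) (All.tabulate bounded)))))
  (code-map (codeIn u) u (codeIn-injective u) (λ a _ → code-colour a (firstIndex a u)) ,
   IsGauss-map (codeIn u) u (codeIn-injective u) g)
  where
  bounded : ∀ {b} → b ∈ code u → b ∈ upTo (n * 2)
  bounded b∈ with ∈-map⁻ (codeIn u) b∈
  ... | a , a∈ , refl = ∈-upTo⁺ (<-≤-trans (+-monoˡ-< (firstIndex a u * 2) (m%n<n a 2))
          (*-monoˡ-≤ 2 (≤-trans (firstIndex-< u a∈) l)))

firstIndex-here : ∀ a w → firstIndex a (a ∷ w) ≡ 0
firstIndex-here a w with a ≟ a
... | yes _  = refl
... | no a≢a = contradiction refl a≢a

firstIndex-there : ∀ {a b} w → a ≢ b → firstIndex a (b ∷ w) ≡ suc (firstIndex a w)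
firstIndex-there {a} {b} w a≢b with a ≟ b
... | yes a≡b = contradiction a≡b a≢b
... | no _    = refl

-- The hypotheses remove, on each side, the term with all three letters and the three terms with
-- two. With at most one letter left the two patterns coincide.
large-terms-vanish : (h : List ℕ → Bool) → h leftH3 ≡ false → h rightH3 ≡ false →
  h (3 ∷ 0 ∷ 1 ∷ 4 ∷ 0 ∷ 5 ∷ 1 ∷ 6 ∷ []) ≡ false → h (3 ∷ 0 ∷ 4 ∷ 0 ∷ 2 ∷ 5 ∷ 2 ∷ 6 ∷ []) ≡ false →
  h (3 ∷ 1 ∷ 4 ∷ 2 ∷ 5 ∷ 1 ∷ 2 ∷ 6 ∷ []) ≡ false → h (3 ∷ 1 ∷ 0 ∷ 4 ∷ 0 ∷ 5 ∷ 1 ∷ 6 ∷ []) ≡ false →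
  h (3 ∷ 0 ∷ 4 ∷ 2 ∷ 0 ∷ 5 ∷ 2 ∷ 6 ∷ []) ≡ false → h (3 ∷ 1 ∷ 4 ∷ 2 ∷ 5 ∷ 2 ∷ 1 ∷ 6 ∷ []) ≡ false →
  sumOver h (0 ∷ 1 ∷ 2 ∷ []) leftH3 ≡ sumOver h (0 ∷ 1 ∷ 2 ∷ []) rightH3
large-terms-vanish h e₁ e₂ e₃ e₄ e₅ e₆ e₇ e₈
  rewrite e₁ | e₂ | e₃ | e₄ | e₅ | e₆ | e₇ | e₈ = refl

module Local {n : ℕ} {t : List Word} (ok : Admissible t n) where
  open Admissible ok

  φ : Word → Bool
  φ = indicator t

  φ-false : ∀ u → (code u ∈ t → ⊥) → φ u ≡ false
  φ-false u u∉ = dec-false (code u ∈ʷ? t) u∉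

  φ-kink : ∀ x A y → A % 2 ≡ 0 → φ (x ++ A ∷ A ∷ y) ≡ false
  φ-kink x A y even = φ-false w λ c∈ → All.lookup irreducible c∈
    (subst (T ∘ hasReduction) (sym (map-++ f x (A ∷ A ∷ y)))
      (kink-hasReduction (map f x) (f A) (map f y) (trans (code-colour A (firstIndex A w)) even)))
    where
    w : Word
    w = x ++ A ∷ A ∷ y
    f : ℕ → ℕ
    f = codeIn w

  φ-bigon : ∀ x A B y z → A % 2 ≡ B % 2 → φ (x ++ A ∷ B ∷ y ++ B ∷ A ∷ z) ≡ false
  φ-bigon x A B y z same = φ-false w λ c∈ → All.lookup irreducible c∈
    (subst (T ∘ hasReduction) (sym (trans (map-++ f x (A ∷ B ∷ y ++ B ∷ A ∷ z))
        (cong (λ v → map f x ++ f A ∷ f B ∷ v) (map-++ f y (B ∷ A ∷ z)))))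
      (bigon-hasReduction (map f x) (f A) (f B) (map f y) (map f z)
        (trans (code-colour A (firstIndex A w)) (trans same (sym (code-colour B (firstIndex B w)))))))
    where
    w : Word
    w = x ++ A ∷ B ∷ y ++ B ∷ A ∷ z
    f : ℕ → ℕ
    f = codeIn w

  φ-long : ∀ u → 4 + n < length u → φ u ≡ false
  φ-long u l = φ-false u λ c∈ → <⇒≱ l (subst (_≤ 4 + n) (code-length u) (All.lookup short c∈))

  side-long : ∀ bs → n < length (plug (frame bs) (3 ∷ 4 ∷ 5 ∷ 6 ∷ [])) →
              (∀ i → i < 3 → length (frame bs i) ≡ 1) → side t leftH3 bs ≡ side t rightH3 bs
  side-long bs long letter
    = large-terms-vanish (φ ∘ plug ρ) (few leftH3 refl) (few rightH3 refl)
        (two (3 ∷ 0 ∷ 1 ∷ 4 ∷ 0 ∷ 5 ∷ 1 ∷ 6 ∷ []) 0 1 (s≤s z≤n) (s≤s (s≤s z≤n)) refl)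
        (two (3 ∷ 0 ∷ 4 ∷ 0 ∷ 2 ∷ 5 ∷ 2 ∷ 6 ∷ []) 0 2 (s≤s z≤n) (s≤s (s≤s (s≤s z≤n))) refl)
        (two (3 ∷ 1 ∷ 4 ∷ 2 ∷ 5 ∷ 1 ∷ 2 ∷ 6 ∷ []) 1 2 (s≤s (s≤s z≤n)) (s≤s (s≤s (s≤s z≤n))) refl)
        (two (3 ∷ 1 ∷ 0 ∷ 4 ∷ 0 ∷ 5 ∷ 1 ∷ 6 ∷ []) 0 1 (s≤s z≤n) (s≤s (s≤s z≤n)) refl)
        (two (3 ∷ 0 ∷ 4 ∷ 2 ∷ 0 ∷ 5 ∷ 2 ∷ 6 ∷ []) 0 2 (s≤s z≤n) (s≤s (s≤s (s≤s z≤n))) refl)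
        (two (3 ∷ 1 ∷ 4 ∷ 2 ∷ 5 ∷ 2 ∷ 1 ∷ 6 ∷ []) 1 2 (s≤s (s≤s z≤n)) (s≤s (s≤s (s≤s z≤n))) refl)
    where
    ρ : ℕ → Word
    ρ = frame bs
    long-double : ∀ k q → k < 3 → length (plug ρ (k ∷ k ∷ q)) ≡ 2 + length (plug ρ q)
    long-double k q k<3 rewrite plug-∷ ρ k q | length-++ (ρ k) {ρ k ++ plug ρ q} | length-++ (ρ k) {plug ρ q}
                              | letter k k<3 = refl
    two : ∀ q i j → i < 3 → j < 3 → sort q ≡ sort (i ∷ i ∷ j ∷ j ∷ 3 ∷ 4 ∷ 5 ∷ 6 ∷ []) → φ (plug ρ q) ≡ false
    two q i j i<3 j<3 eq = φ-long (plug ρ q) (subst (4 + n <_)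
      (sym (trans (↭-length (rearrange ρ q (i ∷ i ∷ j ∷ j ∷ 3 ∷ 4 ∷ 5 ∷ 6 ∷ []) eq))
        (trans (long-double i (j ∷ j ∷ 3 ∷ 4 ∷ 5 ∷ 6 ∷ []) i<3) (cong (2 +_) (long-double j (3 ∷ 4 ∷ 5 ∷ 6 ∷ []) j<3)))))
      (+-monoʳ-≤ 4 long))
    few : ∀ q → sort q ≡ sort (0 ∷ 0 ∷ 1 ∷ 1 ∷ 2 ∷ 2 ∷ 3 ∷ 4 ∷ 5 ∷ 6 ∷ []) → φ (plug ρ q) ≡ false
    few q eq = φ-long (plug ρ q) (subst (4 + n <_)
      (sym (trans (↭-length (rearrange ρ q (0 ∷ 0 ∷ 1 ∷ 1 ∷ 2 ∷ 2 ∷ 3 ∷ 4 ∷ 5 ∷ 6 ∷ []) eq))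
        (trans (long-double 0 (1 ∷ 1 ∷ 2 ∷ 2 ∷ 3 ∷ 4 ∷ 5 ∷ 6 ∷ []) (s≤s z≤n)) (cong (2 +_) (trans (long-double 1 (2 ∷ 2 ∷ 3 ∷ 4 ∷ 5 ∷ 6 ∷ []) (s≤s (s≤s z≤n)))
          (cong (2 +_) (long-double 2 (3 ∷ 4 ∷ 5 ∷ 6 ∷ []) (s≤s (s≤s (s≤s z≤n)))))))))
      ) (≤-trans (+-monoʳ-≤ 4 long) (m≤n+m _ 2)))

  -- Coding relative to `V`, in which A, B, C stand behind `u`, agrees with `code` on `u` and gives
  -- A, B, C the next three indices, which are those reserved by `coloured`. As colours are
  -- preserved, the identity becomes one of those checked on `shortCodes`.
  side-short : ∀ A B C x y z v → let u = x ++ y ++ z ++ v in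
    A ∉ u → B ∉ u → C ∉ u → A ≢ B → A ≢ C → B ≢ C → (A % 2 + B % 2) % 2 ≡ C % 2 →
    IsGauss u → length u ≤ n → side t leftH3 (blocks A B C x y z v) ≡ side t rightH3 (blocks A B C x y z v)
  side-short A B C x y z v A∉ B∉ C∉ A≢B A≢C B≢C balance g l = begin
    side t leftH3 bs                                  ≡⟨ relabel leftH3 ⟩
    side t leftH3 (map (map f) bs)                    ≡⟨ cong (side t leftH3) recolour ⟩
    side t leftH3 (coloured (length (code u)) (A % 2) (B % 2) (map f x) (map f y) (map f z) (map f v))
      ≡⟨ All.lookup (All.lookup (All.lookup (All.lookup (All.lookup (All.lookup relation (code∈shortCodes n u g l))
           split₁) split₂) (∈-splits (map f z) (map f v))) (∈-upTo⁺ (m%n<n A 2))) (∈-upTo⁺ (m%n<n B 2)) ⟩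
    side t rightH3 (coloured (length (code u)) (A % 2) (B % 2) (map f x) (map f y) (map f z) (map f v))
                                                      ≡⟨ cong (side t rightH3) recolour ⟨
    side t rightH3 (map (map f) bs)                   ≡⟨ relabel rightH3 ⟨
    side t rightH3 bs                                 ∎
    where
    open ≡-Reasoning
    u V : Word
    u = x ++ y ++ z ++ v
    V = u ++ A ∷ B ∷ C ∷ []
    f : ℕ → ℕ
    f = codeIn V
    bs : List Word
    bs = blocks A B C x y z v
    letters⊆V : ∀ i {a} → a ∈ frame bs i → a ∈ V
    letters⊆V 0 (here refl) = ∈-++⁺ʳ u (here refl)
    letters⊆V 1 (here refl) = ∈-++⁺ʳ u (there (here refl))
    letters⊆V 2 (here refl) = ∈-++⁺ʳ u (there (there (here refl)))
    letters⊆V 3 a∈ = ∈-++⁺ˡ (∈-++⁺ˡ a∈)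
    letters⊆V 4 a∈ = ∈-++⁺ˡ (∈-++⁺ʳ x (∈-++⁺ˡ a∈))
    letters⊆V 5 a∈ = ∈-++⁺ˡ (∈-++⁺ʳ x (∈-++⁺ʳ y (∈-++⁺ˡ a∈)))
    letters⊆V 6 a∈ = ∈-++⁺ˡ (∈-++⁺ʳ x (∈-++⁺ʳ y (∈-++⁺ʳ z a∈)))
    letters⊆V (suc (suc (suc (suc (suc (suc (suc _))))))) ()
    word⊆V : ∀ q {a} → a ∈ plug (frame bs) q → a ∈ V
    word⊆V q a∈ = let i , _ , a∈i = ∈-plug⁻ (frame bs) q a∈ in letters⊆V i a∈i
    relabel : ∀ p → side t p bs ≡ side t p (map (map f) bs)
    relabel = sumOver-ext (λ q → trans
      (sym (indicator-map t f (plug (frame bs) q)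
        (λ a b a∈ b∈ → codeIn-injective V a b (word⊆V q a∈) (word⊆V q b∈)) (λ a _ → code-colour a (firstIndex a V))))
      (cong φ (map-plug-frame f bs q))) (0 ∷ 1 ∷ 2 ∷ [])
    f-on-u : map f u ≡ code u
    f-on-u = map-cong-local (All.tabulate λ {a} a∈ → cong (λ n → a % 2 + n * 2) (firstIndex-++ˡ u _ a∈))
    image : code u ≡ map f x ++ map f y ++ map f z ++ map f v
    image = trans (sym f-on-u) (trans (map-++ f x (y ++ z ++ v)) (cong (map f x ++_)
      (trans (map-++ f y (z ++ v)) (cong (map f y ++_) (map-++ f z v)))))
    split₁ : (map f x , map f y ++ map f z ++ map f v) ∈ splits (code u)
    split₁ rewrite image = ∈-splits (map f x) (map f y ++ map f z ++ map f v)
    split₂ : (map f y , map f z ++ map f v) ∈ splits (map f y ++ map f z ++ map f v)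
    split₂ = ∈-splits (map f y) _
    fA : f A ≡ A % 2 + length (code u) * 2
    fA rewrite firstIndex-++ʳ {A} u (A ∷ B ∷ C ∷ []) A∉ | code-length u | firstIndex-here A (B ∷ C ∷ [])
      | +-identityʳ (length u) = refl
    fB : f B ≡ B % 2 + suc (length (code u)) * 2
    fB rewrite firstIndex-++ʳ {B} u (A ∷ B ∷ C ∷ []) B∉ | code-length u | firstIndex-there (B ∷ C ∷ []) (A≢B ∘ sym)
      | firstIndex-here B (C ∷ []) | +-comm (length u) 1 = refl
    fC : f C ≡ (A % 2 + B % 2) % 2 + suc (suc (length (code u))) * 2
    fC rewrite firstIndex-++ʳ {C} u (A ∷ B ∷ C ∷ []) C∉ | code-length u | firstIndex-there (B ∷ C ∷ []) (A≢C ∘ sym)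
      | firstIndex-there (C ∷ []) (B≢C ∘ sym) | firstIndex-here C [] | +-comm (length u) 2 | balance = refl
    recolour : map (map f) bs ≡ coloured (length (code u)) (A % 2) (B % 2) (map f x) (map f y) (map f z) (map f v)
    recolour rewrite fA | fB | fC = refl

singleton-∖ : ∀ {A l} → l ≢ A → [ A ] ∖ l ≡ [ A ]
singleton-∖ l≢A = ∖-there [] l≢A

∉-∖ : ∀ {A} l w → A ∉ w → A ∉ w ∖ l
∉-∖ l w A∉ A∈ = A∉ (proj₁ (∈-∖⁻ w A∈))

letter≢ : ∀ {a b : ℕ} w → a ∈ w → b ∉ w → a ≢ b
letter≢ w a∈ b∉ refl = b∉ a∈

letterAt : ∀ bs w {A} k → {True (All.all? (_∈? (k ∷ w ∖ k)) (upTo (length bs)))} →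
           frame bs k ≡ [ A ] → sort w ≡ sort (k ∷ k ∷ w ∖ k) → IsGauss (plug (frame bs) w) → LetterAt (frame bs) k
letterAt bs w {A} k {covered} eq perm g = record
  { letter = A ; occupies = eq ; isolated = separated bs w k {covered} eq perm g }

module Moves-preserve {n : ℕ} {t : List Word} (ok : Admissible t n) where
  open Local ok

  total-H1 : ∀ A x y → IsGauss (x ++ A ∷ A ∷ y) → A % 2 ≡ 0 → total φ (x ++ A ∷ A ∷ y) ≡ total φ (x ++ y)
  total-H1 A x y g even = begin
    total φ (plug ρ w)                               ≡⟨ total-plug φ ρ (atA ∷ []) (1 ∷ 2 ∷ []) w refl ⟩
    sumOver (λ q → Σφ (plug ρ q)) (0 ∷ []) w         ≡⟨ sum-relation φ Good {0 ∷ []} {[]} {w} {1 ∷ 2 ∷ []}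
                                                          local (x ++ y) closed bs (x , y , refl) ⟩
    sumOver (λ q → Σφ (plug ρ q)) [] (1 ∷ 2 ∷ [])    ≡⟨ total-plug φ ρ [] (1 ∷ 2 ∷ []) (1 ∷ 2 ∷ []) refl ⟨
    total φ (plug ρ (1 ∷ 2 ∷ []))                    ∎
    where
    open ≡-Reasoning
    bs : List Word
    bs = [ A ] ∷ x ∷ y ∷ []
    ρ : ℕ → Word
    ρ = frame bs
    w : List ℕ
    w = 1 ∷ 0 ∷ 0 ∷ 2 ∷ []
    Σφ : Word → Bool
    Σφ = sumOver φ (x ++ y)
    atA : LetterAt ρ 0
    atA = letterAt bs w 0 refl refl g
    A∉ : A ∉ x ++ y
    A∉ = ∉-plug ρ (1 ∷ 2 ∷ []) (LetterAt.isolated atA) (toWitnessFalse {a? = 0 ∈? (1 ∷ 2 ∷ [])} _)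
    Good : List Word → Set
    Good bs = ∃₂ λ x y → bs ≡ [ A ] ∷ x ∷ y ∷ []
    local : ∀ bs → Good bs → sumOver (φ ∘ plug (frame bs)) (0 ∷ []) w ≡ φ (plug (frame bs) (1 ∷ 2 ∷ []))
    local _ (x , y , refl) rewrite φ-kink x A y even = refl
    closed : ∀ l bs → l ∈ x ++ y → Good bs → Good (map (_∖ l) bs)
    closed l _ l∈ (x′ , y′ , refl) rewrite singleton-∖ (letter≢ (x ++ y) l∈ A∉) = x′ ∖ l , y′ ∖ l , refl

  total-H2 : ∀ A B x y z → IsGauss (x ++ A ∷ B ∷ y ++ B ∷ A ∷ z) → A % 2 ≡ B % 2 →
             total φ (x ++ A ∷ B ∷ y ++ B ∷ A ∷ z) ≡ total φ (x ++ y ++ z)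
  total-H2 A B x y z g same = begin
    total φ (plug ρ w)                                  ≡⟨ total-plug φ ρ (atA ∷ atB ∷ []) r w refl ⟩
    sumOver (λ q → Σφ (plug ρ q)) (0 ∷ 1 ∷ []) w        ≡⟨ sum-relation φ Good {0 ∷ 1 ∷ []} {[]} {w} {r}
                                                             local (x ++ y ++ z) closed bs (x , y , z , refl , A∉ , B∉) ⟩
    sumOver (λ q → Σφ (plug ρ q)) [] r                  ≡⟨ total-plug φ ρ [] r r refl ⟨
    total φ (plug ρ r)                                  ∎
    where
    open ≡-Reasoning
    bs : List Word
    bs = [ A ] ∷ [ B ] ∷ x ∷ y ∷ z ∷ []
    ρ : ℕ → Word
    ρ = frame bs
    w r : List ℕ
    w = 2 ∷ 0 ∷ 1 ∷ 3 ∷ 1 ∷ 0 ∷ 4 ∷ []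
    r = 2 ∷ 3 ∷ 4 ∷ []
    Σφ : Word → Bool
    Σφ = sumOver φ (x ++ y ++ z)
    atA : LetterAt ρ 0
    atA = letterAt bs w 0 refl refl g
    atB : LetterAt ρ 1
    atB = letterAt bs w 1 refl refl g
    A∉ : A ∉ x ++ y ++ z
    A∉ = ∉-plug ρ r (LetterAt.isolated atA) (toWitnessFalse {a? = 0 ∈? r} _)
    B∉ : B ∉ x ++ y ++ z
    B∉ = ∉-plug ρ r (LetterAt.isolated atB) (toWitnessFalse {a? = 1 ∈? r} _)
    A≢B : A ≢ B
    A≢B A≡B = LetterAt.isolated atA 1 (λ ()) (here A≡B)
    Good : List Word → Set
    Good bs = ∃ λ x → ∃₂ λ y z → bs ≡ [ A ] ∷ [ B ] ∷ x ∷ y ∷ z ∷ [] × A ∉ x ++ y ++ z × B ∉ x ++ y ++ z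
    swapped : ∀ x y z → A ∉ x ++ y ++ z → B ∉ x ++ y ++ z → φ (x ++ B ∷ y ++ B ∷ z) ≡ φ (x ++ A ∷ y ++ A ∷ z)
    swapped x y z A∉ B∉ = trans (cong φ (sym image)) (indicator-map t f v
      (replace-injective B∉v) (λ a _ → colour a))
      where
      ρ′ : ℕ → Word
      ρ′ = frame ([ A ] ∷ [ B ] ∷ x ∷ y ∷ z ∷ [])
      v : Word
      v = x ++ A ∷ y ++ A ∷ z
      f : ℕ → ℕ
      f = replace A B
      colour : ∀ a → f a % 2 ≡ a % 2
      colour a with a ≟ A
      ... | yes refl = sym same
      ... | no _     = refl
      isolatedA : ∀ i → i ≢ 0 → A ∉ ρ′ i
      isolatedA 0 i≢0 = contradiction refl i≢0
      isolatedA 1 _ (here A≡B) = A≢B A≡B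
      isolatedA 2 _ = A∉ ∘ ∈-++⁺ˡ
      isolatedA 3 _ = A∉ ∘ ∈-++⁺ʳ x ∘ ∈-++⁺ˡ
      isolatedA 4 _ = A∉ ∘ ∈-++⁺ʳ x ∘ ∈-++⁺ʳ y
      isolatedA (suc (suc (suc (suc (suc _))))) _ ()
      isolatedB : ∀ i → i ≢ 1 → B ∉ ρ′ i
      isolatedB 0 _ (here B≡A) = A≢B (sym B≡A)
      isolatedB 1 i≢1 = contradiction refl i≢1
      isolatedB 2 _ = B∉ ∘ ∈-++⁺ˡ
      isolatedB 3 _ = B∉ ∘ ∈-++⁺ʳ x ∘ ∈-++⁺ˡ
      isolatedB 4 _ = B∉ ∘ ∈-++⁺ʳ x ∘ ∈-++⁺ʳ y
      isolatedB (suc (suc (suc (suc (suc _))))) _ ()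
      image : map f v ≡ x ++ B ∷ y ++ B ∷ z
      image = map-replace ρ′ {0} {1} refl refl isolatedA (2 ∷ 0 ∷ 3 ∷ 0 ∷ 4 ∷ [])
      B∉v : B ∉ v
      B∉v = ∉-plug ρ′ (2 ∷ 0 ∷ 3 ∷ 0 ∷ 4 ∷ []) isolatedB (toWitnessFalse {a? = 1 ∈? (2 ∷ 0 ∷ 3 ∷ 0 ∷ 4 ∷ [])} _)
    -- Of the four terms, the one with both letters vanishes, those with a single letter cancel
    -- because renaming A to B keeps the colour, and the one without A and B remains.
    local : ∀ bs → Good bs → sumOver (φ ∘ plug (frame bs)) (0 ∷ 1 ∷ []) w ≡ φ (plug (frame bs) r)
    local _ (x , y , z , refl , A∉ , B∉)
      rewrite φ-bigon x A B y z same | swapped x y z A∉ B∉ with φ (x ++ A ∷ y ++ A ∷ z)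
    ... | false = refl
    ... | true = not-involutive _
    closed : ∀ l bs → l ∈ x ++ y ++ z → Good bs → Good (map (_∖ l) bs)
    closed l _ l∈ (x′ , y′ , z′ , refl , A∉′ , B∉′)
      rewrite singleton-∖ (letter≢ (x ++ y ++ z) l∈ A∉) | singleton-∖ (letter≢ (x ++ y ++ z) l∈ B∉) =
      x′ ∖ l , y′ ∖ l , z′ ∖ l , refl , remove A∉′ , remove B∉′
      where
      remove : ∀ {a} → a ∉ x′ ++ y′ ++ z′ → a ∉ x′ ∖ l ++ y′ ∖ l ++ z′ ∖ l
      remove {a} a∉ = subst (a ∉_) (trans (∖-++ l x′ (y′ ++ z′)) (cong (x′ ∖ l ++_) (∖-++ l y′ z′))) (∉-∖ l _ a∉)

  total-H3 : ∀ A B C x y z v → let bs = blocks A B C x y z v in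
             IsGauss (plug (frame bs) leftH3) → (A % 2 + B % 2) % 2 ≡ C % 2 →
             total φ (plug (frame bs) leftH3) ≡ total φ (plug (frame bs) rightH3)
  total-H3 A B C x y z v g balance = begin
    total φ (plug ρ leftH3)                                     ≡⟨ total-plug φ ρ (atA ∷ atB ∷ atC ∷ []) r leftH3 refl ⟩
    sumOver (λ q → Σφ (plug ρ q)) (0 ∷ 1 ∷ 2 ∷ []) leftH3       ≡⟨ sum-relation φ Good {0 ∷ 1 ∷ 2 ∷ []} {0 ∷ 1 ∷ 2 ∷ []} {leftH3} {rightH3}
                                                                     local (plug ρ r) closed bs
                                                                     (x , y , z , v , refl , A∉ , B∉ , C∉ , gr) ⟩
    sumOver (λ q → Σφ (plug ρ q)) (0 ∷ 1 ∷ 2 ∷ []) rightH3      ≡⟨ total-plug φ ρ (atA ∷ atB ∷ atC ∷ []) r rightH3 refl ⟨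
    total φ (plug ρ rightH3)                                    ∎
    where
    open ≡-Reasoning
    bs : List Word
    bs = blocks A B C x y z v
    ρ : ℕ → Word
    ρ = frame bs
    r : List ℕ
    r = 3 ∷ 4 ∷ 5 ∷ 6 ∷ []
    Σφ : Word → Bool
    Σφ = sumOver φ (plug ρ r)
    atA : LetterAt ρ 0
    atA = letterAt bs leftH3 0 refl refl g
    atB : LetterAt ρ 1
    atB = letterAt bs leftH3 1 refl refl g
    atC : LetterAt ρ 2
    atC = letterAt bs leftH3 2 refl refl g
    A∉ : A ∉ plug ρ r
    A∉ = ∉-plug ρ r (LetterAt.isolated atA) (toWitnessFalse {a? = 0 ∈? r} _)
    B∉ : B ∉ plug ρ r
    B∉ = ∉-plug ρ r (LetterAt.isolated atB) (toWitnessFalse {a? = 1 ∈? r} _)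
    C∉ : C ∉ plug ρ r
    C∉ = ∉-plug ρ r (LetterAt.isolated atC) (toWitnessFalse {a? = 2 ∈? r} _)
    gr : IsGauss (plug ρ r)
    gr = gauss-cancel ρ {2 ∷ 2 ∷ r} 2 r refl refl (gauss-cancel ρ {1 ∷ 1 ∷ 2 ∷ 2 ∷ r} 1 (2 ∷ 2 ∷ r) refl refl
      (gauss-cancel ρ {leftH3} 0 (1 ∷ 1 ∷ 2 ∷ 2 ∷ r) refl refl g))
    -- The outer word has to stay Gauss under deletions, since only Gauss words are listed in
    -- `shortCodes`.
    Good : List Word → Set
    Good bs = ∃₂ λ x y → ∃₂ λ z v → let u = x ++ y ++ z ++ v in
      bs ≡ blocks A B C x y z v × A ∉ u × B ∉ u × C ∉ u × IsGauss u
    -- Outer words of length at most `n` are covered by the finite check; for longer ones the length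
    -- bound on the table decides.
    local : ∀ bs → Good bs → side t leftH3 bs ≡ side t rightH3 bs
    local _ (x , y , z , v , refl , A∉ , B∉ , C∉ , gu) with length (x ++ y ++ z ++ v) ≤? n
    ... | yes short = side-short A B C x y z v A∉ B∉ C∉
      (λ A≡B → LetterAt.isolated atA 1 (λ ()) (here A≡B)) (λ A≡C → LetterAt.isolated atA 2 (λ ()) (here A≡C))
      (λ B≡C → LetterAt.isolated atB 2 (λ ()) (here B≡C)) balance gu short
    ... | no long = side-long (blocks A B C x y z v) (≰⇒> long) single
      where
      single : ∀ i → i < 3 → length (frame (blocks A B C x y z v) i) ≡ 1
      single 0 _ = refl
      single 1 _ = refl
      single 2 _ = refl
      single (suc (suc (suc _))) (s≤s (s≤s (s≤s ())))
    closed : ∀ l bs → l ∈ plug ρ r → Good bs → Good (map (_∖ l) bs)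
    closed l _ l∈ (x′ , y′ , z′ , v′ , refl , A∉′ , B∉′ , C∉′ , gu)
      rewrite singleton-∖ (letter≢ (plug ρ r) l∈ A∉) | singleton-∖ (letter≢ (plug ρ r) l∈ B∉) | singleton-∖ (letter≢ (plug ρ r) l∈ C∉) =
      x′ ∖ l , y′ ∖ l , z′ ∖ l , v′ ∖ l , refl , remove A∉′ , remove B∉′ , remove C∉′ ,
      subst IsGauss split (IsGauss-∖ l u gu)
      where
      u : Word
      u = x′ ++ y′ ++ z′ ++ v′
      split : u ∖ l ≡ x′ ∖ l ++ y′ ∖ l ++ z′ ∖ l ++ v′ ∖ l
      split = trans (∖-++ l x′ (y′ ++ z′ ++ v′)) (cong (x′ ∖ l ++_)
        (trans (∖-++ l y′ (z′ ++ v′)) (cong (y′ ∖ l ++_) (∖-++ l z′ v′))))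
      remove : ∀ {a} → a ∉ u → a ∉ x′ ∖ l ++ y′ ∖ l ++ z′ ∖ l ++ v′ ∖ l
      remove {a} a∉ = subst (a ∉_) split (∉-∖ l u a∉)

-- Colouring letters by parity

-- The parity of the number of occurrences of a at the places where the alternating
-- sequence k, not k, k, … is true.  A letter of a Gauss word is linked with an even number
-- of letters exactly when its two places have opposite parity.
placeParity : ℕ → Bool → Word → Bool
placeParity a k [] = false
placeParity a k (b ∷ w) = (does (a ≟ b) ∧ k) xor placeParity a (not k) w

shiftBy : Word → Bool → Bool
shiftBy [] k = k
shiftBy (_ ∷ x) k = shiftBy x (not k)

placeParity-here : ∀ a k w → placeParity a k (a ∷ w) ≡ k xor placeParity a (not k) w
placeParity-here a k w rewrite dec-true (a ≟ a) refl = refl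

placeParity-there : ∀ {a b} k w → a ≢ b → placeParity a k (b ∷ w) ≡ placeParity a (not k) w
placeParity-there {a} {b} k w a≢b rewrite dec-false (a ≟ b) a≢b = refl

placeParity-++ : ∀ {a} k x w → a ∉ x → placeParity a k (x ++ w) ≡ placeParity a (shiftBy x k) w
placeParity-++ k [] w a∉ = refl
placeParity-++ k (b ∷ x) w a∉ =
  trans (placeParity-there k (x ++ w) (a∉ ∘ here)) (placeParity-++ (not k) x w (a∉ ∘ there))

placeParity-absent : ∀ {a} k w → a ∉ w → placeParity a k w ≡ false
placeParity-absent k [] a∉ = refl
placeParity-absent k (b ∷ w) a∉ =
  trans (placeParity-there k w (a∉ ∘ here)) (placeParity-absent (not k) w (a∉ ∘ there))

-- The places behind the deleted pair move by two, which does not affect their parity.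
placeParity-delete : ∀ {a b c} k x w → a ≢ b → a ≢ c → placeParity a k (x ++ b ∷ c ∷ w) ≡ placeParity a k (x ++ w)
placeParity-delete {b = b} {c} k [] w a≢b a≢c rewrite placeParity-there k (c ∷ w) a≢b
  | placeParity-there (not k) w a≢c | not-involutive k = refl
placeParity-delete {a} k (d ∷ x) w a≢b a≢c = cong ((does (a ≟ d) ∧ k) xor_) (placeParity-delete (not k) x w a≢b a≢c)

-- The difference is required for every phase `k`, because a common prefix changes the phase.
DiffersBy : ℕ → Bool → Word → Word → Set
DiffersBy a m u v = ∀ k → placeParity a k u ≡ m xor placeParity a k v

placeParity-context : ∀ a m x u v → DiffersBy a m u v → DiffersBy a m (x ++ u) (x ++ v)
placeParity-context a m [] u v eq k = eq k
placeParity-context a m (b ∷ x) u v eq k rewrite placeParity-context a m x u v eq (not k) =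
  move (does (a ≟ b) ∧ k) m (placeParity a (not k) (x ++ v))
  where
  move : ∀ p q r → p xor (q xor r) ≡ q xor (p xor r)
  move = solve 3 (λ p q r → p :+ (q :+ r) := q :+ (p :+ r)) refl

placeParity-swap : ∀ a m b c u v → DiffersBy a m u v →
                   DiffersBy a ((does (a ≟ b) xor does (a ≟ c)) xor m) (b ∷ c ∷ u) (c ∷ b ∷ v)
placeParity-swap a m b c u v eq k rewrite eq (not (not k)) =
  move (does (a ≟ b)) (does (a ≟ c)) k m (placeParity a (not (not k)) v)
  where
  move : ∀ p q k m r → (p ∧ k) xor ((q ∧ not k) xor (m xor r)) ≡
                       ((p xor q) xor m) xor ((q ∧ k) xor ((p ∧ not k) xor r))
  move = solve 5 (λ p q k m r → (p :* k) :+ ((q :* (con true :+ k)) :+ (m :+ r)) :=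
                       ((p :+ q) :+ m) :+ ((q :* k) :+ ((p :* (con true :+ k)) :+ r))) refl

-- Each of A, B, C lies in exactly two of the interchanged pairs and moves by one place in both, so
-- its two changes of parity cancel.
placeParity-H3 : ∀ a A B C x y z t →
  placeParity a false (x ++ A ∷ B ∷ y ++ A ∷ C ∷ z ++ B ∷ C ∷ t) ≡
  placeParity a false (x ++ B ∷ A ∷ y ++ C ∷ A ∷ z ++ C ∷ B ∷ t)
placeParity-H3 a A B C x y z t =
  trans (placeParity-context a m₁ x (A ∷ B ∷ u₁) (B ∷ A ∷ v₁) first-pair false)
    (cong (_xor placeParity a false (x ++ B ∷ A ∷ v₁)) (cancel (does (a ≟ A)) (does (a ≟ B)) (does (a ≟ C))))
  where
  u₁ v₁ u₂ v₂ : Word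
  u₂ = z ++ B ∷ C ∷ t
  v₂ = z ++ C ∷ B ∷ t
  u₁ = y ++ A ∷ C ∷ u₂
  v₁ = y ++ C ∷ A ∷ v₂
  m₁ m₂ m₃ : Bool
  m₃ = (does (a ≟ B) xor does (a ≟ C)) xor false
  m₂ = (does (a ≟ A) xor does (a ≟ C)) xor m₃
  m₁ = (does (a ≟ A) xor does (a ≟ B)) xor m₂
  third-pair : DiffersBy a m₃ u₂ v₂
  third-pair = placeParity-context a m₃ z (B ∷ C ∷ t) (C ∷ B ∷ t) (placeParity-swap a false B C t t (λ _ → refl))
  second-pair : DiffersBy a m₂ u₁ v₁
  second-pair = placeParity-context a m₂ y (A ∷ C ∷ u₂) (C ∷ A ∷ v₂) (placeParity-swap a m₃ A C u₂ v₂ third-pair)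
  first-pair : DiffersBy a m₁ (A ∷ B ∷ u₁) (B ∷ A ∷ v₁)
  first-pair = placeParity-swap a m₂ A B u₁ v₁ second-pair
  cancel : ∀ p q r → (p xor q) xor ((p xor r) xor ((q xor r) xor false)) ≡ false
  cancel = solve 3 (λ p q r → (p :+ q) :+ ((p :+ r) :+ ((q :+ r) :+ con false)) := con false) refl

placeParity-map : ∀ f a k w → (∀ b → b ∈ w → f a ≡ f b → a ≡ b) → placeParity (f a) k (map f w) ≡ placeParity a k w
placeParity-map f a k [] inj = refl
placeParity-map f a k (b ∷ w) inj =
  cong₂ (λ p q → (p ∧ k) xor q) same (placeParity-map f a (not k) w (λ c c∈ → inj c (there c∈)))
  where
  same : does (f a ≟ f b) ≡ does (a ≟ b)
  same with a ≟ b
  ... | yes refl = trans (dec-true (f a ≟ f a) refl) (sym (dec-true (a ≟ a) refl))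
  ... | no a≢b   = trans (dec-false (f a ≟ f b) (a≢b ∘ inj b (here refl))) (sym (dec-false (a ≟ b) a≢b))

-- Residue 0 stands for an even letter, whose two places have opposite parity and for which
-- `placeParity` is therefore `true`.
bit : Bool → ℕ
bit false = 1
bit true  = 0

bit<2 : ∀ k → bit k < 2
bit<2 false = s≤s (s≤s z≤n)
bit<2 true  = s≤s z≤n

tint : Word → ℕ → ℕ
tint w a = bit (placeParity a false w) + a * 2

paint : Word → Word
paint w = map (tint w) w

tint-injective : ∀ w {a b} → tint w a ≡ tint w b → a ≡ b
tint-injective w {a} {b} = tag-injective (bit<2 (placeParity a false w)) (bit<2 (placeParity b false w))

tint-colour : ∀ w a → tint w a % 2 ≡ bit (placeParity a false w)
tint-colour w a = tag-colour _ a (bit<2 (placeParity a false w))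

IsGauss-paint : ∀ w → IsGauss w → IsGauss (map (tint w) w)
IsGauss-paint w = IsGauss-map (tint w) w (λ _ _ _ _ → tint-injective w)

-- Letters that survive a move keep their colour, so a single renaming `tint u` paints both sides
-- and the coloured moves apply.
paint-agree : ∀ u v → (∀ a → a ∈ v → placeParity a false u ≡ placeParity a false v) → paint v ≡ map (tint u) v
paint-agree u v eq = map-cong-local (All.tabulate λ {a} a∈ → cong (λ k → bit k + a * 2) (sym (eq a a∈)))

map-∖ : ∀ g A w → (∀ b → b ∈ w → g A ≡ g b → A ≡ b) → map g w ∖ g A ≡ map g (w ∖ A)
map-∖ g A [] inj = refl
map-∖ g A (b ∷ w) inj with A ≟ b
... | yes refl rewrite ∖-here A w | ∖-here (g A) (map g w) = map-∖ g A w (λ b b∈ → inj b (there b∈))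
... | no A≢b rewrite ∖-there w A≢b | ∖-there (map g w) (A≢b ∘ inj b (here refl)) =
  cong (g b ∷_) (map-∖ g A w (λ b b∈ → inj b (there b∈)))

module Value {n : ℕ} {t : List Word} (ok : Admissible t n) where
  open Local ok using (φ)
  open Moves-preserve ok

  sumOver-map : ∀ g v → InjectiveOn g v → (∀ a → a ∈ v → g a % 2 ≡ a % 2) →
    ∀ ls w → (∀ {a} → a ∈ ls → a ∈ v) → (∀ {a} → a ∈ w → a ∈ v) → sumOver φ (map g ls) (map g w) ≡ sumOver φ ls w
  sumOver-map g v inj par [] w _ w⊆ =
    indicator-map t g w (λ a b a∈ b∈ → inj a b (w⊆ a∈) (w⊆ b∈)) (λ a a∈ → par a (w⊆ a∈))
  sumOver-map g v inj par (l ∷ ls) w ls⊆ w⊆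
    rewrite map-∖ g l w (λ b b∈ → inj l b (ls⊆ (here refl)) (w⊆ b∈)) =
    cong₂ _xor_ (sumOver-map g v inj par ls w (ls⊆ ∘ there) w⊆)
      (sumOver-map g v inj par ls (w ∖ l) (ls⊆ ∘ there) (w⊆ ∘ proj₁ ∘ ∈-∖⁻ w))

  total-map : ∀ g w → InjectiveOn g w → (∀ a → a ∈ w → g a % 2 ≡ a % 2) → total φ (map g w) ≡ total φ w
  total-map g w inj par = trans (sumOver-deduplicate φ (map g w) (map g w))
    (trans (sumOver-map g w inj par w w (λ a∈ → a∈) (λ a∈ → a∈)) (sym (sumOver-deduplicate φ w w)))

  value : Word → Bool
  value w = total φ (paint w)

  value-Iso : ∀ {u v} → Iso u v → value u ≡ value v
  value-Iso {u} (f , inj , refl) = sym (trans (cong (total φ) repaint) (total-map g (paint u) g-inj g-par))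
    where
    v : Word
    v = map f u
    g : ℕ → ℕ
    -- Halving removes the paint and recovers the letter; `g` is thus `f` carried over to the
    -- painted words.
    g b = tint v (f (b / 2))
    g-tint : ∀ a → g (tint u a) ≡ tint v (f a)
    g-tint a = cong (tint v ∘ f) (half-tag a (bit<2 (placeParity a false u)))
    repaint : paint v ≡ map g (paint u)
    repaint = begin
      map (tint v) (map f u)         ≡⟨ map-∘ u ⟨
      map (tint v ∘ f) u             ≡⟨ map-cong-local (All.tabulate λ {a} _ → sym (g-tint a)) ⟩
      map (g ∘ tint u) u             ≡⟨ map-∘ u ⟩
      map g (map (tint u) u)         ∎
      where open ≡-Reasoning
    g-inj : InjectiveOn g (paint u)
    g-inj b c b∈ c∈ eq with ∈-map⁻ (tint u) b∈ | ∈-map⁻ (tint u) c∈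
    ... | a , a∈ , refl | d , d∈ , refl = cong (tint u) (inj a d a∈ d∈
      (tint-injective v (trans (sym (g-tint a)) (trans eq (g-tint d)))))
    g-par : ∀ b → b ∈ paint u → g b % 2 ≡ b % 2
    g-par b b∈ with ∈-map⁻ (tint u) b∈
    ... | a , a∈ , refl = begin
      g (tint u a) % 2                   ≡⟨ cong (_% 2) (g-tint a) ⟩
      tint v (f a) % 2                   ≡⟨ tint-colour v (f a) ⟩
      bit (placeParity (f a) false v)    ≡⟨ cong bit (placeParity-map f a false u (λ b → inj a b a∈)) ⟩
      bit (placeParity a false u)        ≡⟨ tint-colour u a ⟨
      tint u a % 2                       ∎
      where open ≡-Reasoning

  value-H1 : ∀ x y A → IsGauss (x ++ A ∷ A ∷ y) → value (x ++ A ∷ A ∷ y) ≡ value (x ++ y)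
  value-H1 x y A g = begin
    total φ (paint w)                          ≡⟨ cong (total φ) painted ⟩
    total φ (map τ x ++ τ A ∷ τ A ∷ map τ y)   ≡⟨ total-H1 (τ A) (map τ x) (map τ y) (subst IsGauss painted (IsGauss-paint w g)) even ⟩
    total φ (map τ x ++ map τ y)               ≡⟨ cong (total φ) (map-++ τ x y) ⟨
    total φ (map τ (x ++ y))                   ≡⟨ cong (total φ) (paint-agree w (x ++ y) agree) ⟨
    total φ (paint (x ++ y))                   ∎
    where
    open ≡-Reasoning
    w : Word
    w = x ++ A ∷ A ∷ y
    τ : ℕ → ℕ
    τ = tint w
    painted : paint w ≡ map τ x ++ τ A ∷ τ A ∷ map τ y
    painted = map-++ τ x (A ∷ A ∷ y)
    bs : List Word
    bs = [ A ] ∷ x ∷ y ∷ []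
    isolatedA : ∀ i → i ≢ 0 → A ∉ frame bs i
    isolatedA = separated bs (1 ∷ 0 ∷ 0 ∷ 2 ∷ []) 0 refl refl g
    A∉ : A ∉ x ++ y
    A∉ = ∉-plug (frame bs) (1 ∷ 2 ∷ []) isolatedA (toWitnessFalse {a? = 0 ∈? (1 ∷ 2 ∷ [])} _)
    agree : ∀ a → a ∈ x ++ y → placeParity a false w ≡ placeParity a false (x ++ y)
    agree a a∈ = placeParity-delete false x y (letter≢ (x ++ y) a∈ A∉) (letter≢ (x ++ y) a∈ A∉)
    -- The copies of A are adjacent, so exactly one of them is counted.
    parity : placeParity A false w ≡ true
    parity rewrite placeParity-++ {A} false x (A ∷ A ∷ y) (isolatedA 1 (λ ()))
      | placeParity-here A (shiftBy x false) (A ∷ y) | placeParity-here A (not (shiftBy x false)) y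
      | placeParity-absent {A} (not (not (shiftBy x false))) y (isolatedA 2 (λ ())) with shiftBy x false
    ... | false = refl
    ... | true  = refl
    even : τ A % 2 ≡ 0
    even = trans (tint-colour w A) (cong bit parity)

  value-H2 : ∀ x y z A B → IsGauss (x ++ A ∷ B ∷ y ++ B ∷ A ∷ z) → value (x ++ A ∷ B ∷ y ++ B ∷ A ∷ z) ≡ value (x ++ y ++ z)
  value-H2 x y z A B g = begin
    total φ (paint w)                                  ≡⟨ cong (total φ) painted ⟩
    total φ (map τ x ++ τ A ∷ τ B ∷ map τ y ++ τ B ∷ τ A ∷ map τ z)
      ≡⟨ total-H2 (τ A) (τ B) (map τ x) (map τ y) (map τ z) (subst IsGauss painted (IsGauss-paint w g)) same ⟩
    total φ (map τ x ++ map τ y ++ map τ z)            ≡⟨ cong (total φ) (map-plug-frame τ bs r) ⟨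
    total φ (map τ (x ++ y ++ z))                      ≡⟨ cong (total φ) (paint-agree w (x ++ y ++ z) agree) ⟨
    total φ (paint (x ++ y ++ z))                      ∎
    where
    open ≡-Reasoning
    w : Word
    w = x ++ A ∷ B ∷ y ++ B ∷ A ∷ z
    τ : ℕ → ℕ
    τ = tint w
    p r : List ℕ
    p = 2 ∷ 0 ∷ 1 ∷ 3 ∷ 1 ∷ 0 ∷ 4 ∷ []
    r = 2 ∷ 3 ∷ 4 ∷ []
    bs : List Word
    bs = [ A ] ∷ [ B ] ∷ x ∷ y ∷ z ∷ []
    painted : paint w ≡ map τ x ++ τ A ∷ τ B ∷ map τ y ++ τ B ∷ τ A ∷ map τ z
    painted = map-plug-frame τ bs p
    isolatedA : ∀ i → i ≢ 0 → A ∉ frame bs i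
    isolatedA = separated bs p 0 refl refl g
    isolatedB : ∀ i → i ≢ 1 → B ∉ frame bs i
    isolatedB = separated bs p 1 refl refl g
    A∉ : A ∉ x ++ y ++ z
    A∉ = ∉-plug (frame bs) r isolatedA (toWitnessFalse {a? = 0 ∈? r} _)
    B∉ : B ∉ x ++ y ++ z
    B∉ = ∉-plug (frame bs) r isolatedB (toWitnessFalse {a? = 1 ∈? r} _)
    A≢B : A ≢ B
    A≢B A≡B = isolatedA 1 (λ ()) (here A≡B)
    agree : ∀ a → a ∈ x ++ y ++ z → placeParity a false w ≡ placeParity a false (x ++ y ++ z)
    agree a a∈ = trans (placeParity-delete false x (y ++ B ∷ A ∷ z) a≢A a≢B)
      (trans (cong (placeParity a false) (sym (++-assoc x y (B ∷ A ∷ z))))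
        (trans (placeParity-delete false (x ++ y) z a≢B a≢A) (cong (placeParity a false) (++-assoc x y z))))
      where
      a≢A : a ≢ A
      a≢A = letter≢ (x ++ y ++ z) a∈ A∉
      a≢B : a ≢ B
      a≢B = letter≢ (x ++ y ++ z) a∈ B∉
    -- A stands at places i and j + 1, B at i + 1 and j; the two sums have the same parity.
    parity : placeParity A false w ≡ placeParity B false w
    parity rewrite placeParity-++ {A} false x (A ∷ B ∷ y ++ B ∷ A ∷ z) (isolatedA 2 (λ ()))
      | placeParity-++ {B} false x (A ∷ B ∷ y ++ B ∷ A ∷ z) (isolatedB 2 (λ ()))
      with shiftBy x false
    ... | k rewrite placeParity-here A k (B ∷ y ++ B ∷ A ∷ z) | placeParity-there (not k) (y ++ B ∷ A ∷ z) A≢B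
      | placeParity-there k (B ∷ y ++ B ∷ A ∷ z) (A≢B ∘ sym) | placeParity-here B (not k) (y ++ B ∷ A ∷ z)
      | placeParity-++ {A} (not (not k)) y (B ∷ A ∷ z) (isolatedA 3 (λ ()))
      | placeParity-++ {B} (not (not k)) y (B ∷ A ∷ z) (isolatedB 3 (λ ()))
      with shiftBy y (not (not k))
    ... | m rewrite placeParity-there m (A ∷ z) A≢B | placeParity-here A (not m) z | placeParity-here B m (A ∷ z)
      | placeParity-there (not m) z (A≢B ∘ sym)
      | placeParity-absent {A} (not (not m)) z (isolatedA 4 (λ ()))
      | placeParity-absent {B} (not (not m)) z (isolatedB 4 (λ ())) with k | m
    ... | false | false = refl
    ... | false | true  = refl
    ... | true  | false = refl
    ... | true  | true  = refl
    same : τ A % 2 ≡ τ B % 2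
    same = trans (tint-colour w A) (trans (cong bit parity) (sym (tint-colour w B)))

  value-H3 : ∀ x y z v A B C → IsGauss (x ++ A ∷ B ∷ y ++ A ∷ C ∷ z ++ B ∷ C ∷ v) →
    value (x ++ A ∷ B ∷ y ++ A ∷ C ∷ z ++ B ∷ C ∷ v) ≡ value (x ++ B ∷ A ∷ y ++ C ∷ A ∷ z ++ C ∷ B ∷ v)
  value-H3 x y z v A B C g = begin
    total φ (paint w)                                  ≡⟨ cong (total φ) painted ⟩
    total φ (plug (frame (blocks (τ A) (τ B) (τ C) (map τ x) (map τ y) (map τ z) (map τ v))) leftH3)
      ≡⟨ total-H3 (τ A) (τ B) (τ C) (map τ x) (map τ y) (map τ z) (map τ v) (subst IsGauss painted (IsGauss-paint w g)) balance ⟩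
    total φ (plug (frame (blocks (τ A) (τ B) (τ C) (map τ x) (map τ y) (map τ z) (map τ v))) rightH3)
                                                       ≡⟨ cong (total φ) (map-plug-frame τ bs rightH3) ⟨
    total φ (map τ w′)                                 ≡⟨ cong (total φ) (paint-agree w w′ (λ a _ → placeParity-H3 a A B C x y z v)) ⟨
    total φ (paint w′)                                 ∎
    where
    open ≡-Reasoning
    w w′ : Word
    w = x ++ A ∷ B ∷ y ++ A ∷ C ∷ z ++ B ∷ C ∷ v
    w′ = x ++ B ∷ A ∷ y ++ C ∷ A ∷ z ++ C ∷ B ∷ v
    τ : ℕ → ℕ
    τ = tint w
    bs : List Word
    bs = blocks A B C x y z v
    painted : paint w ≡ plug (frame (blocks (τ A) (τ B) (τ C) (map τ x) (map τ y) (map τ z) (map τ v))) leftH3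
    painted = map-plug-frame τ bs leftH3
    isolatedA : ∀ i → i ≢ 0 → A ∉ frame bs i
    isolatedA = separated bs leftH3 0 refl refl g
    isolatedB : ∀ i → i ≢ 1 → B ∉ frame bs i
    isolatedB = separated bs leftH3 1 refl refl g
    isolatedC : ∀ i → i ≢ 2 → C ∉ frame bs i
    isolatedC = separated bs leftH3 2 refl refl g
    A≢B : A ≢ B
    A≢B A≡B = isolatedA 1 (λ ()) (here A≡B)
    A≢C : A ≢ C
    A≢C A≡C = isolatedA 2 (λ ()) (here A≡C)
    B≢C : B ≢ C
    B≢C B≡C = isolatedB 2 (λ ()) (here B≡C)
    k m l : Bool
    k = shiftBy x false
    m = shiftBy y (not (not k))
    l = shiftBy z (not (not m))
    parityA : placeParity A false w ≡ k xor m
    parityA rewrite placeParity-++ {A} false x (A ∷ B ∷ y ++ A ∷ C ∷ z ++ B ∷ C ∷ v) (isolatedA 3 (λ ()))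
      | placeParity-here A k (B ∷ y ++ A ∷ C ∷ z ++ B ∷ C ∷ v)
      | placeParity-there (not k) (y ++ A ∷ C ∷ z ++ B ∷ C ∷ v) A≢B
      | placeParity-++ {A} (not (not k)) y (A ∷ C ∷ z ++ B ∷ C ∷ v) (isolatedA 4 (λ ()))
      | placeParity-here A m (C ∷ z ++ B ∷ C ∷ v)
      | placeParity-absent {A} (not m) (C ∷ z ++ B ∷ C ∷ v)
          (∉-plug (frame bs) (2 ∷ 5 ∷ 1 ∷ 2 ∷ 6 ∷ []) isolatedA (toWitnessFalse {a? = 0 ∈? (2 ∷ 5 ∷ 1 ∷ 2 ∷ 6 ∷ [])} _))
      | xor-identityʳ m = refl
    parityB : placeParity B false w ≡ not k xor l
    parityB rewrite placeParity-++ {B} false x (A ∷ B ∷ y ++ A ∷ C ∷ z ++ B ∷ C ∷ v) (isolatedB 3 (λ ()))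
      | placeParity-there k (B ∷ y ++ A ∷ C ∷ z ++ B ∷ C ∷ v) (A≢B ∘ sym)
      | placeParity-here B (not k) (y ++ A ∷ C ∷ z ++ B ∷ C ∷ v)
      | placeParity-++ {B} (not (not k)) y (A ∷ C ∷ z ++ B ∷ C ∷ v) (isolatedB 4 (λ ()))
      | placeParity-there m (C ∷ z ++ B ∷ C ∷ v) (A≢B ∘ sym)
      | placeParity-there (not m) (z ++ B ∷ C ∷ v) B≢C
      | placeParity-++ {B} (not (not m)) z (B ∷ C ∷ v) (isolatedB 5 (λ ()))
      | placeParity-here B l (C ∷ v)
      | placeParity-absent {B} (not l) (C ∷ v)
          (∉-plug (frame bs) (2 ∷ 6 ∷ []) isolatedB (toWitnessFalse {a? = 1 ∈? (2 ∷ 6 ∷ [])} _))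
      | xor-identityʳ l = refl
    parityC : placeParity C false w ≡ not m xor not l
    parityC rewrite placeParity-++ {C} false x (A ∷ B ∷ y ++ A ∷ C ∷ z ++ B ∷ C ∷ v) (isolatedC 3 (λ ()))
      | placeParity-there k (B ∷ y ++ A ∷ C ∷ z ++ B ∷ C ∷ v) (A≢C ∘ sym)
      | placeParity-there (not k) (y ++ A ∷ C ∷ z ++ B ∷ C ∷ v) (B≢C ∘ sym)
      | placeParity-++ {C} (not (not k)) y (A ∷ C ∷ z ++ B ∷ C ∷ v) (isolatedC 4 (λ ()))
      | placeParity-there m (C ∷ z ++ B ∷ C ∷ v) (A≢C ∘ sym)
      | placeParity-here C (not m) (z ++ B ∷ C ∷ v)
      | placeParity-++ {C} (not (not m)) z (B ∷ C ∷ v) (isolatedC 5 (λ ()))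
      | placeParity-there l (C ∷ v) (B≢C ∘ sym)
      | placeParity-here C (not l) v
      | placeParity-absent {C} (not (not l)) v (isolatedC 6 (λ ()))
      | xor-identityʳ (not l) = refl
    -- The arguments are the phases at the starts of the three pairs. A comes first in both of its
    -- pairs, C second in both, B second and then first. Each phase enters two of the letters, so it
    -- drops out of the sum of the three bits.
    bits : ∀ k m n → (bit (k xor m) + bit (not k xor n)) % 2 ≡ bit (not m xor not n)
    bits false false false = refl
    bits false false true = refl
    bits false true false = refl
    bits false true true = refl
    bits true false false = refl
    bits true false true = refl
    bits true true false = refl
    bits true true true = refl
    balance : (τ A % 2 + τ B % 2) % 2 ≡ τ C % 2
    balance rewrite tint-colour w A | tint-colour w B | tint-colour w C | parityA | parityB | parityC = bits k m l

  value-invariant : ∀ {u v} → Homotopic u v → value u ≡ value v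
  value-invariant h-refl = refl
  value-invariant (h-sym h) = sym (value-invariant h)
  value-invariant (h-trans h k) = trans (value-invariant h) (value-invariant k)
  value-invariant (h-iso _ iso) = value-Iso iso
  value-invariant (h-move (H1 x y A g _)) = value-H1 x y A g
  value-invariant (h-move (H2 x y z A B g _)) = value-H2 x y z A B g
  value-invariant (h-move (H3 x y z v A B C g _)) = value-H3 x y z v A B C g

-- Separation of the rows

signature : Word → List Bool
signature w = map (λ t → total (indicator (proj₂ t)) (paint w)) tables

-- The admissibility proofs enter only here, where each entry is recognised as a `Value.value`;
-- `signature` itself is free of them and can be evaluated on the table.
signature-invariant : ∀ {u v} → Homotopic u v → signature u ≡ signature v
signature-invariant h = map-cong-local (All.map (λ ok → Value.value-invariant ok h) tables-admissible)

Apart : List (List Bool) → List (List Bool) → Set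
Apart ss ss′ = All (λ s → All (λ s′ → s ≢ s′) ss′) ss

-- Words are compared only across different rows, so nothing is asserted about the two halves of row
-- 1.
rows-apart : AllPairs Apart (map (map signature) rowTable)
rows-apart = decided (allPairs? (λ ss ss′ → All.all? (λ s → All.all? (λ s′ → ¬? (≡-dec Bool._≟_ s s′)) ss′) ss)
  (map (map signature) rowTable)) refl

nth-∈ : ∀ {u} i rs → u ∈ nth i rs → nth i rs ∈ rs
nth-∈ zero (r ∷ rs) u∈ = here refl
nth-∈ (suc i) (r ∷ rs) u∈ = there (nth-∈ i rs u∈)

nth-apart : ∀ {rs} → AllPairs Apart (map (map signature) rs) → ∀ {i j u v} → i < j →
            u ∈ nth i rs → v ∈ nth j rs → signature u ≢ signature v
nth-apart {r ∷ rs} (apart ∷ _) {zero} {suc j} _ u∈ v∈ =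
  All.lookup (All.lookup (All.lookup apart (∈-map⁺ (map signature) (nth-∈ j rs v∈))) (∈-map⁺ signature u∈)) (∈-map⁺ signature v∈)
nth-apart {r ∷ rs} (_ ∷ aparts) {suc i} {suc j} (s≤s i<j) u∈ v∈ = nth-apart aparts i<j u∈ v∈

rows-not-Homotopic : ∀ i j → i ≢ j → ∀ u v → u ∈ row i → v ∈ row j → ¬ Homotopic u v
rows-not-Homotopic i j i≢j u v u∈ v∈ h with <-cmp i j
... | tri< i<j _ _ = nth-apart rows-apart i<j u∈ v∈ (signature-invariant h)
... | tri≈ _ i≡j _ = i≢j i≡j
... | tri> _ _ j<i = nth-apart rows-apart j<i v∈ u∈ (sym (signature-invariant h))

theorem5p3 : ((∀ (i : ℕ) → 2 ≤ i → i ≤ 38 → ∀ (u v : Word) → u ∈ row i → v ∈ row i → Homotopic u v)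
    × Homotopic w₁ w₂ × Homotopic w₃ w₄)
    × (∀ (i j : ℕ) → 1 ≤ i → i ≤ 38 → 1 ≤ j → j ≤ 38 → i ≢ j →
    ∀ (u v : Word) → u ∈ row i → v ∈ row j → ¬ Homotopic u v)
    × (∀ (w : Word) → IsGauss w → rank w ≤ 5 →
    (∀ (i : ℕ) (u : Word) → u ∈ row i → ¬ Iso w u) →
    Homotopic w [] ⊎ Σ Word (λ v → IsGauss v × rank v ≤ 4 × Homotopic w v))
theorem5p3 = (rows , w₁~w₂ , w₃~w₄) , (λ i j _ _ _ _ → rows-not-Homotopic i j) ,
  λ w g r notRow → inj₂ (reduces w g r notRow)
  where
  rows : ∀ i → 2 ≤ i → i ≤ 38 → ∀ u v → u ∈ row i → v ∈ row i → Homotopic u v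
  rows (suc (suc i)) (s≤s (s≤s z≤n)) _ u v = connected⇒Homotopic (nth i (drop 2 rowTable)) (nth-All _ rows-connected i)
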